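{- Let $F/C$ be a separable field extension, let $c$ be a well-ordered $p$-basis of $C$, and let $a$ be a well-ordered subset of $F$. There exists a subset $\lambda_{F/c}a$ of $F$ such that (i) $\Lambda_F C(a)=C(\lambda_{F/c}a)$, and (ii) every element of $\lambda_{F/c}a$ is the value in $F$ of an $\mathfrak{L}_\lambda$-term evaluated at elements of $c\cup a$. If moreover $a,b\subseteq F$ are finite and $F=C(a,b)$, then (iii) there is a finite subset $\lambda_{F/b/c}a\subseteq\lambda_{F/c}a$ such that $\Lambda_F C(a)=C(\lambda_{F/b/c}a)$.
   Context: Here $p$ is the characteristic exponent of $F$ (the characteristic if it is positive, and $1$ otherwise), $\mathbb{F}$ is the prime field, and $F^{(p)}=\{x^p : x\in F\}$. For subfields/subsets, $E(A)$ is the subfield of $F$ generated by $E\cup A$. An extension $F/C$ is separable if $F$ is linearly disjoint from $C^{1/p}$ over $C$. A subset $A\subseteq F$ is $p$-independent in $F$ if $x\notin F^{(p)}(A\setminus\{x\})$ for all $x\in A$; it is a $p$-basis of $F$ if in addition $F=F^{(p)}(A)$. $\Lambda$-closure: for any field extension $F/D$ there is a smallest (with respect to inclusion) subfield $E$ with $D\subseteq E\subseteq F$ and $F/E$ separable (a theorem of Deveney and Mordeson); it is denoted $\Lambda_F D$. Lambda functions: if $b=(b_0,\dots,b_{n-1})$ is a tuple of distinct elements forming a $p$-independent set in $F$ and $x\in F^{(p)}(b)$, then there is a unique family $(\lambda^b_I(x))_{I\in\{0,\dots,p-1\}^n}$ of elements of $F$ with $x=\sum_I b^I\lambda_I^b(x)^p$,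 where $b^I=\prod_i b_i^{I(i)}$. $\mathfrak{L}_\lambda$ is the language consisting of one $(1+n)$-ary function symbol $l_{q,I}(x,y_0,\dots,y_{n-1})$ for each prime $q$, each $n\in\mathbb{N}$ and each $I\in\{0,\dots,q-1\}^n$. A field $F$ is regarded as an $\mathfrak{L}_\lambda$-structure by letting $l_{q,I}(x,b)=\lambda_I^b(x)$ if $q=\mathrm{char}(F)$, $b$ is $p$-independent in $F$ and $x\in F^{(p)}(b)$, and $l_{q,I}(x,b)=0$ otherwise. An $\mathfrak{L}_\lambda$-term is built from variables using only these function symbols. -}

module Defs where

open import Level using (Level; suc)
open import Algebra.Apartness.Bundles using (HeytingCommutativeRing; HeytingField)
open import Algebra.Bundles using (CommutativeRing; Semiring)
open import Algebra.Morphism.Structures using (IsRingHomomorphism)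
import Algebra.Definitions.RawSemiring as RawSemiringDefinitions
open import Axiom.ExcludedMiddle using (ExcludedMiddle)
open import Data.Fin.Base using (Fin; toℕ)
open import Data.Nat.Base as ℕ using (ℕ)
open import Data.Nat.Divisibility using (_∣_)
open import Data.Nat.Primality using (Prime)
open import Data.Product.Base using (Σ; ∃; ∃-syntax; _×_; _,_; proj₁)
open import Data.Unit.Polymorphic.Base using (⊤)
open import Data.Vec.Base using (Vec; []; _∷_; lookup)
open import Data.Vec.Functional using (Vector)
open import Function.Base using (_on_)
open import Function.Bundles using (_⇔_)
open import Induction.WellFounded using (WellFounded)
open import Relation.Binary.Core using (Rel)
open import Relation.Binary.Definitions using (_Respects_)
open import Relation.Binary.PropositionalEquality.Core using (_≡_; _≢_)
open import Relation.Binary.Structures using (IsStrictTotalOrder)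
open import Relation.Nullary.Decidable.Core using (yes; no)
open import Relation.Nullary.Negation.Core using (¬_)
open import Relation.Unary using (Pred; _∈_; _⊆_; _≐_; _∪_)

-- Terms of the language 𝔏_λ: the symbol l_{q,I} has arity 1 + n, where
-- I ∈ {0,…,q-1}ⁿ.
data Term {v : Level} (V : Set v) : Set v where
  var : V → Term V
  l   : ∀ {q n} → Prime q → Vec (Fin q) n → Term V → Vector (Term V) n → Term V

-- Under excluded middle, which the classical theory assumes, the apartness of a
-- Heyting field is by tightness the negation of ≈, so Heyting fields are exactly
-- the fields of classical algebra.
module Over {ℓ : Level} (F : HeytingField ℓ ℓ ℓ) where

  ring : CommutativeRing ℓ ℓ
  ring = HeytingCommutativeRing.commutativeRing (HeytingField.heytingCommutativeRing F)

  open CommutativeRing ring public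
    using (Carrier; _≈_; _+_; _*_; -_; 0#; 1#; semiring; rawRing)
  open RawSemiringDefinitions (Semiring.rawSemiring semiring) public
    using (sum; product; _^_) renaming (_×_ to _·_)

  Subset : Set (suc ℓ)
  Subset = Pred Carrier ℓ

  Whole : Subset
  Whole _ = ⊤

  Range : ∀ {n} → Vector Carrier n → Subset
  Range b x = ∃[ i ] x ≈ b i

  IsFinite : Subset → Set ℓ
  IsFinite A = ∃[ n ] Σ (Vector Carrier n) λ b → A ≐ Range b

  infixl 7 _∖_
  _∖_ : Subset → Carrier → Subset
  (A ∖ x) y = y ∈ A × ¬ (y ≈ x)

  -- The order lives on Σ Carrier A, where two elements are identified when their
  -- underlying field elements are.
  record WellOrder (A : Subset) : Set (suc ℓ) where
    field
      _<_                : Rel (Σ Carrier A) ℓ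
      isStrictTotalOrder : IsStrictTotalOrder (_≈_ on proj₁) _<_
      wellFounded        : WellFounded _<_

  record IsSubfield (K : Subset) : Set ℓ where
    field
      resp-≈     : K Respects _≈_
      0-closed   : 0# ∈ K
      1-closed   : 1# ∈ K
      +-closed   : ∀ {x y} → x ∈ K → y ∈ K → (x + y) ∈ K
      neg-closed : ∀ {x} → x ∈ K → (- x) ∈ K
      *-closed   : ∀ {x y} → x ∈ K → y ∈ K → (x * y) ∈ K
      inv-closed : ∀ {x y} → x ∈ K → x * y ≈ 1# → y ∈ K

  data Generated (A : Subset) : Subset where
    gen  : ∀ {x} → x ∈ A → x ∈ Generated A
    resp : ∀ {x y} → x ≈ y → x ∈ Generated A → y ∈ Generated A
    zero : 0# ∈ Generated A
    one  : 1# ∈ Generated A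
    add  : ∀ {x y} → x ∈ Generated A → y ∈ Generated A → (x + y) ∈ Generated A
    neg  : ∀ {x} → x ∈ Generated A → (- x) ∈ Generated A
    mul  : ∀ {x y} → x ∈ Generated A → y ∈ Generated A → (x * y) ∈ Generated A
    inv  : ∀ {x y} → x ∈ Generated A → x * y ≈ 1# → y ∈ Generated A

  infix 8 _⟨_⟩
  _⟨_⟩ : Subset → Subset → Subset
  E ⟨ A ⟩ = Generated (E ∪ A)

  IsCharacteristic : ℕ → Set ℓ
  IsCharacteristic n = ∀ m → (m · 1# ≈ 0#) ⇔ (n ∣ m)

  data IsCharacteristicExponent : ℕ → Set ℓ where
    characteristic-zero     : IsCharacteristic 0 → IsCharacteristicExponent 1
    characteristic-positive : ∀ {n} → n ≢ 0 → IsCharacteristic n →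
                              IsCharacteristicExponent n

  infix 9 _^⦅_⦆
  _^⦅_⦆ : Subset → ℕ → Subset
  (K ^⦅ p ⦆) x = ∃[ y ] y ∈ K × x ≈ y ^ p

  IsPIndependent : ℕ → Subset → Subset → Set ℓ
  IsPIndependent p K A =
    A ⊆ K × (∀ x → x ∈ A → ¬ (x ∈ (K ^⦅ p ⦆) ⟨ A ∖ x ⟩))

  IsPBasis : ℕ → Subset → Subset → Set ℓ
  IsPBasis p K A = IsPIndependent p K A × K ≐ (K ^⦅ p ⦆) ⟨ A ⟩

  LinearlyIndependent : Subset → ∀ {n} → Vector Carrier n → Set ℓ
  LinearlyIndependent k {n} v =
    (a : Vector Carrier n) → (∀ i → a i ∈ k) →
    sum (λ i → a i * v i) ≈ 0# → ∀ i → a i ≈ 0#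

  LinearlyDisjoint : Subset → Subset → Subset → Set ℓ
  LinearlyDisjoint k K L =
    ∀ n (v : Vector Carrier n) → (∀ i → v i ∈ K) →
    LinearlyIndependent k v → LinearlyIndependent L v

  -- A tuple counts as p-independent only if its entries are distinct.
  IsPIndependentTuple : ℕ → ∀ {n} → Vector Carrier n → Set ℓ
  IsPIndependentTuple p b =
    (∀ i j → b i ≈ b j → i ≡ j) × IsPIndependent p Whole (Range b)

  monomial : ∀ {q n} → Vector Carrier n → Vec (Fin q) n → Carrier
  monomial b I = product (λ i → b i ^ toℕ (lookup I i))

  sumExponents : ∀ q n → (Vec (Fin q) n → Carrier) → Carrier
  sumExponents q ℕ.zero    f = f []
  sumExponents q (ℕ.suc n) f = sum (λ i → sumExponents q n (λ I → f (i ∷ I)))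

  IsLambdaFamily : ∀ q {n} → Vector Carrier n → Carrier →
                   (Vec (Fin q) n → Carrier) → Set ℓ
  IsLambdaFamily q {n} b x f =
    x ≈ sumExponents q n (λ I → monomial b I * f I ^ q)

  module Interpretation (em : ExcludedMiddle ℓ) where

    -- Definite description: when b is p-independent and x ∈ F^(p)(b), there is a
    -- unique such family up to ≈; the default value 0# is then never taken.
    lambda : ∀ q {n} → Vector Carrier n → Vec (Fin q) n → Carrier → Carrier
    lambda q {n} b I x with em {∃ (IsLambdaFamily q b x)}
    ... | yes (f , _) = f I
    ... | no _        = 0#

    -- Only q = char F matters here, so q also serves as the characteristic
    -- exponent in the remaining two conditions.
    ⟦l⟧ : ∀ {q n} → Vec (Fin q) n → Carrier → Vector Carrier n → Carrier
    ⟦l⟧ {q} I x b with em {IsCharacteristic q × IsPIndependentTuple q b ×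
                           x ∈ (Whole ^⦅ q ⦆) ⟨ Range b ⟩}
    ... | yes _ = lambda q b I x
    ... | no _  = 0#

    ⟦_⟧ : ∀ {v} {V : Set v} → Term V → (V → Carrier) → Carrier
    ⟦ var y ⟧    ρ = ρ y
    ⟦ l _ I t u ⟧ ρ = ⟦l⟧ I (⟦ t ⟧ ρ) (λ i → ⟦ u i ⟧ ρ)

    IsTermValue : Subset → Carrier → Set ℓ
    IsTermValue A x =
      ∃[ m ] Σ (Term (Fin m)) λ t → Σ (Vector Carrier m) λ ρ →
        (∀ i → ρ i ∈ A) × x ≈ ⟦ t ⟧ ρ

module _ {ℓ : Level} (F : HeytingField ℓ ℓ ℓ) where
  open Over F

  record Overfield : Set (suc ℓ) where
    field
      Ω : HeytingField ℓ ℓ ℓ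
      ι : Carrier → Over.Carrier Ω
      ι-isRingHomomorphism : IsRingHomomorphism rawRing (Over.rawRing Ω) ι

    module Ω = Over Ω

    image : Subset → Ω.Subset
    image K y = ∃[ x ] x ∈ K × y Ω.≈ ι x

    roots : ℕ → Subset → Ω.Subset
    roots p K y = (y Ω.^ p) ∈ image K

    HasRoots : ℕ → Subset → Set ℓ
    HasRoots p K = ∀ x → x ∈ K → ∃[ y ] (y Ω.^ p) Ω.≈ ι x

  -- F/C is separable when F is linearly disjoint from C^{1/p} over C.  The
  -- comparison takes place in an overfield Ω of F which contains C^{1/p}, that is,
  -- in which all elements of C have p-th roots.  As p-th roots are unique, the
  -- compositum of F and C^{1/p} does not depend on Ω up to isomorphism over F, so
  -- the choice of Ω is immaterial.
  IsSeparable : ℕ → Subset → Set (suc ℓ)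
  IsSeparable p C = Σ Overfield λ E → let open Overfield E in
    HasRoots p C × Ω.LinearlyDisjoint (image C) (image Whole) (roots p C)

  -- E = Λ_F D
  record IsLambdaClosure (p : ℕ) (D E : Subset) : Set (suc ℓ) where
    field
      isSubfield  : IsSubfield E
      contains    : D ⊆ E
      isSeparable : IsSeparable p E
      smallest    : ∀ E′ → IsSubfield E′ → D ⊆ E′ → IsSeparable p E′ → E ⊆ E′

-- Let T be the set of all values of 𝔏_λ-terms at elements of c ∪ a; we take λ_{F/c} a = T.
--
-- F/E is separable iff p-th powers of elements of F that are linearly independent over E are
-- again linearly independent over E: the roots of E can be compared with F inside F itself,
-- embedded in F by Frobenius.
--
-- C(T) is contained in every E ⊇ C(a) with F/E separable: if b ∈ E is p-independent in F and
-- x ∈ E is the sum of the bᴵ λ_Iᵖ, expand the λ_I in a basis over E containing 1; comparing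
-- coefficients shows λ_I ∈ E.  Conversely F/C(T) is separable: finitely many elements of C(T)
-- lie in C(T)ᵖ(t) for a finite tuple t from T, because C = Cᵖ(c); if b is a maximal
-- p-independent subtuple of t, then the λ-coordinates of t with respect to b lie in T, so the
-- given elements lie in C(T)ᵖ(b), where linear independence can be tested on coordinates.
--
-- That monomials in a p-independent tuple are linearly independent over Fᵖ reduces to one
-- element b outside a field K ⊇ Fᵖ; there, b d/db is well defined on K(b), and applying it
-- shortens any relation between 1, b, …, bᵖ⁻¹.
--
-- Finally C(T) lies between C and the finitely generated extension F of C, so it is finitely
-- generated over C, and its generators involve only finitely many elements of T.

module Submission where

open import Defs
open import Algebra.Apartness.Bundles using (HeytingField)
import Algebra.Apartness.Properties.HeytingCommutativeRing as HeytingProperties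
open import Algebra.Bundles using (CommutativeRing; RawRing)
import Algebra.Morphism.Construct.Identity as Identity
open import Algebra.Morphism.Structures using (IsRingHomomorphism)
import Algebra.Properties.CommutativeSemiring.Exp as Exp
import Algebra.Properties.Monoid.Mult as MonoidMult
import Algebra.Properties.Semiring.Exp as SemiringExp
import Algebra.Properties.Semiring.Mult as SemiringMult
import Algebra.Properties.Semiring.Sum as SemiringSum
import Algebra.Solver.Ring as RingSolver
open import Algebra.Solver.Ring.AlmostCommutativeRing using (fromCommutativeRing; _-Raw-AlmostCommutative⟶_)
open import Axiom.ExcludedMiddle using (ExcludedMiddle)
open import Data.Fin.Base using (Fin; zero; suc; toℕ; fromℕ; fromℕ<; inject₁; _↑ˡ_; _↑ʳ_; splitAt; finToFun; funToFin)
import Data.Fin.Properties as Fin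
open import Data.Fin.Relation.Unary.Top using (View; view; ‵fromℕ; ‵inject₁)
open import Data.Maybe.Base using (Maybe; just; nothing)
open import Data.Nat.Base as ℕ using (ℕ; zero; suc; s≤s; z<s)
open import Data.Nat.Combinatorics using (nCk+nC[k+1]≡[n+1]C[k+1]; k>n⇒nCk≡0; nCn≡1) renaming (_C_ to _choose_)
open import Data.Nat.Divisibility using (_∣_; divides; ∣⇒≤; ∣-refl; ∣-antisym; ∣1⇒≡1; 0∣⇒≡0)
open import Data.Nat.Primality using (Prime; irreducible⇒prime; prime⇒nonZero; prime⇒nonTrivial)
import Data.Nat.Properties as ℕ
open import Data.Product.Base using (Σ; ∃; ∃-syntax; _×_; _,_; proj₁; proj₂)
open import Data.Sum.Base using (_⊎_; inj₁; inj₂)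
open import Data.Unit.Polymorphic.Base using (⊤)
open import Data.Vec.Base as Vec using (Vec; []; _∷_)
open import Data.Vec.Functional as Vector using (Vector; tail; _++_)
import Data.Vec.Functional.Properties as Vector
import Data.Vec.Properties as Vec
open import Function.Base using (_∘_; id)
open import Function.Bundles using (Equivalence; mk⇔)
open import Relation.Binary.Definitions using (_Respects_)
open import Relation.Binary.PropositionalEquality as ≡ using (_≡_; _≢_)
open import Relation.Nullary.Decidable.Core using (Dec; yes; no)
open import Relation.Nullary.Negation.Core using (¬_; contradiction)
open import Relation.Unary using (_∈_; _⊆_; _∪_; _≐_)

-- The hard point is the independence of 1, b, ..., bᵖ⁻¹ over K, which amounts to the irreducibility
-- of Xᵖ - bᵖ. It is reached without factoring polynomials: the coordinates of bⁿ with respect to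
-- K-independent vectors are sequences in K, and multiplication by b becomes the shift E. All of
-- them are killed by Eᵖ - bᵖ = (E - b)ᵖ, and since b is not in K, one of them is not killed by E -
-- b. A suitable power of E - b turns it into a sequence that grows like n bⁿ and still satisfies
-- every K-relation between the powers of b; this is what makes b d/db well defined. The identity
-- for (E + y)ᵖ, read on geometric sequences, also yields the additivity of Frobenius.
--
-- In characteristic 0 the exponent is 1, every extension is separable and all symbols take the
-- value 0; the content lies in positive characteristic.
--
-- Finite generation of an intermediate field E rests on a comparison of coefficients: if K ⊆ E ⊆
-- K(x) and K contains the coefficients of the minimal polynomial of x over E, or x is
-- transcendental over E, then E = K.

-- Integer coefficients, as formal differences of natural numbers, let the ring
-- solver cancel terms in a commutative ring without decidable equality.
module DifferenceSolver {c ℓ} (R : CommutativeRing c ℓ) where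
  open CommutativeRing R
  open MonoidMult +-monoid using (×-homo-+; ×-congˡ) renaming (_×_ to _·_)
  open import Algebra.Properties.Ring ring using (-‿distribˡ-*; -‿distribʳ-*; -‿involutive; -0#≈0#; -‿+-comm)
  open import Algebra.Properties.AbelianGroup +-abelianGroup using (⁻¹-anti-homo‿-)
  open import Algebra.Properties.CommutativeSemigroup +-commutativeSemigroup using (interchange)
  open SemiringMult semiring using (×1-homo-*)
  open import Relation.Binary.Reasoning.Setoid setoid
  private
    coefficients : RawRing _ _
    coefficients = record
      { Carrier = ℕ × ℕ
      ; _≈_ = _≡_
      ; _+_ = λ (a , b) (c , d) → a ℕ.+ c , b ℕ.+ d
      ; _*_ = λ (a , b) (c , d) → a ℕ.* c ℕ.+ b ℕ.* d , a ℕ.* d ℕ.+ b ℕ.* c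
      ; -_  = λ (a , b) → b , a
      ; 0#  = 0 , 0
      ; 1#  = 1 , 0
      }

    open RawRing coefficients using () renaming (_+_ to _+ᶜ_; _*_ to _*ᶜ_; -_ to -ᶜ_)

    difference : ℕ × ℕ → Carrier
    difference (a , b) = a · 1# + - (b · 1#)

    -- Special cases make con (0 , 0) and con (1 , 0) denote 0# and 1# on the nose.
    ⟦_⟧ : ℕ × ℕ → Carrier
    ⟦ 0 , 0 ⟧ = 0#
    ⟦ 1 , 0 ⟧ = 1#
    ⟦ a , b ⟧ = difference (a , b)

    ⟦⟧≈difference : ∀ x → ⟦ x ⟧ ≈ difference x
    ⟦⟧≈difference (0 , 0)           = sym (-‿inverseʳ 0#)
    ⟦⟧≈difference (1 , 0)           = sym (trans (+-cong (+-identityʳ 1#) -0#≈0#) (+-identityʳ 1#))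
    ⟦⟧≈difference (0 , suc b)       = refl
    ⟦⟧≈difference (1 , suc b)       = refl
    ⟦⟧≈difference (suc (suc a) , b) = refl

    ·-homo-*+* : ∀ a b c d → (a ℕ.* b ℕ.+ c ℕ.* d) · 1# ≈
                 (a · 1#) * (b · 1#) + (c · 1#) * (d · 1#)
    ·-homo-*+* a b c d = trans (×-homo-+ 1# (a ℕ.* b) (c ℕ.* d))
                               (+-cong (×1-homo-* a b) (×1-homo-* c d))

    difference-+ : ∀ x y → difference (x +ᶜ y) ≈ difference x + difference y
    difference-+ (a , b) (c , d) = begin
      (a ℕ.+ c) · 1# + - ((b ℕ.+ d) · 1#)
        ≈⟨ +-cong (×-homo-+ 1# a c) (-‿cong (×-homo-+ 1# b d)) ⟩
      (a · 1# + c · 1#) + - (b · 1# + d · 1#)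
        ≈⟨ +-congˡ (-‿+-comm (b · 1#) (d · 1#)) ⟨
      (a · 1# + c · 1#) + (- (b · 1#) + - (d · 1#))
        ≈⟨ interchange (a · 1#) (c · 1#) (- (b · 1#)) (- (d · 1#)) ⟩
      difference (a , b) + difference (c , d) ∎

    *-differences : ∀ a b c d → (a * c + b * d) + - (a * d + b * c) ≈ (a + - b) * (c + - d)
    *-differences a b c d = begin
      (a * c + b * d) + - (a * d + b * c)
        ≈⟨ +-congˡ (-‿+-comm (a * d) (b * c)) ⟨
      (a * c + b * d) + (- (a * d) + - (b * c))
        ≈⟨ interchange (a * c) (b * d) (- (a * d)) (- (b * c)) ⟩
      (a * c + - (a * d)) + (b * d + - (b * c))
        ≈⟨ +-congˡ (+-comm (b * d) (- (b * c))) ⟩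
      (a * c + - (a * d)) + (- (b * c) + b * d)
        ≈⟨ +-cong (+-congˡ (-‿distribʳ-* a d))
             (+-cong (-‿distribˡ-* b c) (trans (sym (-‿involutive (b * d)))
               (trans (-‿cong (-‿distribʳ-* b d)) (-‿distribˡ-* b (- d))))) ⟩
      (a * c + a * - d) + (- b * c + - b * - d)
        ≈⟨ +-cong (distribˡ a c (- d)) (distribˡ (- b) c (- d)) ⟨
      a * (c + - d) + - b * (c + - d)
        ≈⟨ distribʳ (c + - d) a (- b) ⟨
      (a + - b) * (c + - d) ∎

    difference-* : ∀ x y → difference (x *ᶜ y) ≈ difference x * difference y
    difference-* (a , b) (c , d) = begin
      (a ℕ.* c ℕ.+ b ℕ.* d) · 1# + - ((a ℕ.* d ℕ.+ b ℕ.* c) · 1#)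
        ≈⟨ +-cong (·-homo-*+* a c b d) (-‿cong (·-homo-*+* a d b c)) ⟩
      _ ≈⟨ *-differences (a · 1#) (b · 1#) (c · 1#) (d · 1#) ⟩
      difference (a , b) * difference (c , d) ∎

    difference-neg : ∀ x → difference (-ᶜ x) ≈ - difference x
    difference-neg (a , b) = sym (⁻¹-anti-homo‿- (a · 1#) (b · 1#))

    ⟦⟧-homo : coefficients -Raw-AlmostCommutative⟶ fromCommutativeRing R
    ⟦⟧-homo = record
      { ⟦_⟧    = ⟦_⟧
      ; +-homo = λ x y → trans (⟦⟧≈difference (x +ᶜ y)) (trans (difference-+ x y)
                   (sym (+-cong (⟦⟧≈difference x) (⟦⟧≈difference y))))
      ; *-homo = λ x y → trans (⟦⟧≈difference (x *ᶜ y)) (trans (difference-* x y)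
                   (sym (*-cong (⟦⟧≈difference x) (⟦⟧≈difference y))))
      ; -‿homo = λ x → trans (⟦⟧≈difference (-ᶜ x)) (trans (difference-neg x)
                   (sym (-‿cong (⟦⟧≈difference x))))
      ; 0-homo = refl
      ; 1-homo = refl
      }

    difference-shift : ∀ x d → difference (x +ᶜ (d , d)) ≈ difference x
    difference-shift x d = trans (difference-+ x (d , d))
      (trans (+-congˡ (-‿inverseʳ (d · 1#))) (+-identityʳ (difference x)))

    -- The pairs (a , b) and (c , d) stand for the same integer exactly when a + d = c + b.
    -- Coefficients that agree only modulo the characteristic are not recognised.
    ⟦⟧-≟ : ∀ x y → Maybe (⟦ x ⟧ ≈ ⟦ y ⟧)
    ⟦⟧-≟ (a , b) (c , d) with a ℕ.+ d ℕ.≟ c ℕ.+ b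
    ... | no _  = nothing
    ... | yes e = just (begin
      ⟦ a , b ⟧                       ≈⟨ ⟦⟧≈difference (a , b) ⟩
      difference (a , b)              ≈⟨ difference-shift (a , b) d ⟨
      difference (a ℕ.+ d , b ℕ.+ d)  ≡⟨ ≡.cong₂ (λ m n → difference (m , n)) e (ℕ.+-comm b d) ⟩
      difference (c ℕ.+ b , d ℕ.+ b)  ≈⟨ difference-shift (c , d) b ⟩
      difference (c , d)              ≈⟨ ⟦⟧≈difference (c , d) ⟨
      ⟦ c , d ⟧                       ∎)

  open RingSolver coefficients (fromCommutativeRing R) ⟦⟧-homo ⟦⟧-≟ public

-- Linear algebra over a subfield, and subfields given by generators.

module FieldTheory {ℓ} (F : HeytingField ℓ ℓ ℓ) (em : ExcludedMiddle ℓ) where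
  open Over F
  open CommutativeRing ring public
    using (refl; sym; trans; setoid; reflexive; +-cong; +-congˡ; +-congʳ; *-cong; *-congˡ; *-congʳ; -‿cong;
           +-identityˡ; +-identityʳ; +-comm; *-identityˡ; *-identityʳ; *-assoc; *-comm;
           zeroˡ; zeroʳ; distribˡ; distribʳ; -‿inverseʳ; commutativeSemiring)
  open import Algebra.Properties.Ring (CommutativeRing.ring ring) public
    using (-‿distribˡ-*; -‿distribʳ-*; -0#≈0#; -‿involutive)
    renaming (x∙y⁻¹≈ε⇒x≈y to x-y≈0⇒x≈y)
  open SemiringSum semiring public
    using (sum-cong-≋; sum-replicate-zero; ∑-distrib-+; ∑-comm; *-distribˡ-sum; *-distribʳ-sum)
  open SemiringExp semiring public using (^-congˡ; ^-homo-*)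
  open Exp commutativeSemiring public using (^-distrib-*)
  open DifferenceSolver ring public using (solve; _:+_; _:*_; :-_; con; _:=_)
  open import Relation.Binary.Reasoning.Setoid setoid

  1≉0 : ¬ (1# ≈ 0#)
  1≉0 1≈0 = HeytingField.#-irrefl F 1≈0
    (HeytingProperties.1#0 (HeytingField.heytingCommutativeRing F))

  inverse : ∀ {x} → ¬ (x ≈ 0#) → ∃[ y ] x * y ≈ 1#
  inverse {x} x≉0 with em {HeytingField._#_ F x 0#}
  ... | no ¬x#0 = contradiction (proj₁ (HeytingField.tight F x 0#) ¬x#0) x≉0
  ... | yes x#0 with HeytingField.#⇒invertible F x#0
  ...   | y , _ , [x-0]y≈1 = y ,
    trans (*-congʳ (sym (trans (+-congˡ -0#≈0#) (+-identityʳ x)))) [x-0]y≈1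

  xy≈0∧x≉0⇒y≈0 : ∀ {x y} → x * y ≈ 0# → ¬ (x ≈ 0#) → y ≈ 0#
  xy≈0∧x≉0⇒y≈0 {x} {y} xy≈0 x≉0 with inverse x≉0
  ... | z , xz≈1 = begin
    y             ≈⟨ *-identityˡ y ⟨
    1# * y        ≈⟨ *-congʳ xz≈1 ⟨
    x * z * y     ≈⟨ solve 3 (λ x y z → x :* z :* y := z :* (x :* y)) refl x y z ⟩
    z * (x * y)   ≈⟨ *-congˡ xy≈0 ⟩
    z * 0#        ≈⟨ zeroʳ z ⟩
    0#            ∎

  *-≉0 : ∀ {x y} → ¬ (x ≈ 0#) → ¬ (y ≈ 0#) → ¬ (x * y ≈ 0#)
  *-≉0 x≉0 y≉0 xy≈0 = y≉0 (xy≈0∧x≉0⇒y≈0 xy≈0 x≉0)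

  x^n≈0⇒x≈0 : ∀ n {x} → x ^ n ≈ 0# → x ≈ 0#
  x^n≈0⇒x≈0 zero    1≈0 = contradiction 1≈0 1≉0
  x^n≈0⇒x≈0 (suc n) {x} x^n≈0 with em {x ≈ 0#}
  ... | yes x≈0 = x≈0
  ... | no x≉0  = x^n≈0⇒x≈0 n (xy≈0∧x≉0⇒y≈0 x^n≈0 x≉0)

  1^n≈1 : ∀ n → 1# ^ n ≈ 1#
  1^n≈1 zero    = refl
  1^n≈1 (suc n) = trans (*-identityˡ (1# ^ n)) (1^n≈1 n)

  sum-zero : ∀ {n} {f : Vector Carrier n} → (∀ i → f i ≈ 0#) → sum f ≈ 0#
  sum-zero {n} f≈0 = trans (sum-cong-≋ f≈0) (sum-replicate-zero n)

  sum-neg : ∀ {n} (f : Vector Carrier n) → sum (λ i → - f i) ≈ - sum f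
  sum-neg {zero}  f = sym -0#≈0#
  sum-neg {suc n} f = trans (+-congˡ (sum-neg (tail f)))
    (solve 2 (λ x y → (:- x) :+ (:- y) := :- (x :+ y)) refl (f zero) (sum (tail f)))

  *-sum-commute : ∀ {n} x (f g : Vector Carrier n) →
                  x * sum (λ i → f i * g i) ≈ sum (λ i → x * f i * g i)
  *-sum-commute x f g = trans (*-distribˡ-sum x (λ i → f i * g i))
    (sum-cong-≋ (λ i → sym (*-assoc x (f i) (g i))))

  single : ∀ {n} → Fin n → Carrier → Vector Carrier n
  single zero    x = x Vector.∷ λ _ → 0#
  single (suc i) x = 0# Vector.∷ single i x

  single-≢ : ∀ {n} {i j : Fin n} x → i ≢ j → single i x j ≈ 0#
  single-≢ {i = zero}  {zero}  x i≢j = contradiction ≡.refl i≢j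
  single-≢ {i = zero}  {suc j} x i≢j = refl
  single-≢ {i = suc i} {zero}  x i≢j = refl
  single-≢ {i = suc i} {suc j} x i≢j = single-≢ x (i≢j ∘ ≡.cong suc)

  single-≡ : ∀ {n} (i : Fin n) x → single i x i ≈ x
  single-≡ zero    x = refl
  single-≡ (suc i) x = single-≡ i x

  sum-single : ∀ {n} (i : Fin n) x (u : Vector Carrier n) → sum (λ j → single i x j * u j) ≈ x * u i
  sum-single zero    x u = trans (+-congˡ (sum-zero (λ j → zeroˡ (u (suc j))))) (+-identityʳ (x * u zero))
  sum-single (suc i) x u = trans (+-congʳ (zeroˡ (u zero))) (trans (+-identityˡ _) (sum-single i x (tail u)))

  module SubfieldProperties {K : Subset} (K-isSubfield : IsSubfield K) where
    open IsSubfield K-isSubfield public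

    ^-closed : ∀ {x} n → x ∈ K → (x ^ n) ∈ K
    ^-closed zero    x∈K = 1-closed
    ^-closed (suc n) x∈K = *-closed x∈K (^-closed n x∈K)

    sum-closed : ∀ {n} {f : Vector Carrier n} → (∀ i → f i ∈ K) → sum f ∈ K
    sum-closed {zero}  f∈K = 0-closed
    sum-closed {suc n} f∈K = +-closed (f∈K zero) (sum-closed (f∈K ∘ suc))

    product-closed : ∀ {n} {f : Vector Carrier n} → (∀ i → f i ∈ K) → product f ∈ K
    product-closed {zero}  f∈K = 1-closed
    product-closed {suc n} f∈K = *-closed (f∈K zero) (product-closed (f∈K ∘ suc))

    ·-closed : ∀ {x} n → x ∈ K → (n · x) ∈ K
    ·-closed zero    x∈K = 0-closed
    ·-closed (suc n) x∈K = +-closed x∈K (·-closed n x∈K)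

    ∷-closed : ∀ {n x} {f : Vector Carrier n} → x ∈ K → (∀ i → f i ∈ K) → ∀ i → (x Vector.∷ f) i ∈ K
    ∷-closed x∈K f∈K zero    = x∈K
    ∷-closed x∈K f∈K (suc i) = f∈K i

    single-closed : ∀ {n x} (i : Fin n) → x ∈ K → ∀ j → single i x j ∈ K
    single-closed zero    x∈K zero    = x∈K
    single-closed zero    x∈K (suc j) = 0-closed
    single-closed (suc i) x∈K zero    = 0-closed
    single-closed (suc i) x∈K (suc j) = single-closed i x∈K j

    -- A record rather than a Σ-type, so that u can be inferred from x ∈ Span u.
    record Span {n} (u : Vector Carrier n) (x : Carrier) : Set ℓ where
      constructor combination
      field
        coefficient   : Vector Carrier n
        coefficient∈K : ∀ i → coefficient i ∈ K
        expansion     : x ≈ sum (λ i → coefficient i * u i)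

    module _ {n} {u : Vector Carrier n} where

      span-resp : (Span u) Respects _≈_
      span-resp x≈y (combination a a∈K x≈) = combination a a∈K (trans (sym x≈y) x≈)

      span-zero : 0# ∈ Span u
      span-zero = combination (λ _ → 0#) (λ _ → 0-closed) (sym (sum-zero (λ i → zeroˡ (u i))))

      span-+ : ∀ {x y} → x ∈ Span u → y ∈ Span u → (x + y) ∈ Span u
      span-+ (combination a a∈K x≈) (combination b b∈K y≈) = combination
        (λ i → a i + b i) (λ i → +-closed (a∈K i) (b∈K i))
        (trans (+-cong x≈ y≈) (trans (sym (∑-distrib-+ (λ i → a i * u i) (λ i → b i * u i)))
          (sum-cong-≋ (λ i → sym (distribʳ (u i) (a i) (b i))))))

      span-* : ∀ {k x} → k ∈ K → x ∈ Span u → (k * x) ∈ Span u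
      span-* {k} k∈K (combination a a∈K x≈) = combination
        (λ i → k * a i) (λ i → *-closed k∈K (a∈K i)) (trans (*-congˡ x≈) (*-sum-commute k a u))

      span-neg : ∀ {x} → x ∈ Span u → (- x) ∈ Span u
      span-neg {x} x∈ = span-resp (trans (sym (-‿distribˡ-* 1# x)) (-‿cong (*-identityˡ x)))
        (span-* (neg-closed 1-closed) x∈)

      span-sum : ∀ {m} {f : Vector Carrier m} → (∀ j → f j ∈ Span u) → sum f ∈ Span u
      span-sum {zero}  f∈ = span-zero
      span-sum {suc m} f∈ = span-+ (f∈ zero) (span-sum (f∈ ∘ suc))

      span-trans : ∀ {m} {v : Vector Carrier m} → (∀ j → v j ∈ Span u) → Span v ⊆ Span u
      span-trans v∈ (combination a a∈K x≈) = span-resp (sym x≈) (span-sum (λ j → span-* (a∈K j) (v∈ j)))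

    span-tail : ∀ {n} (u : Vector Carrier (suc n)) {x} → x ∈ Span (tail u) → x ∈ Span u
    span-tail u (combination a a∈K x≈) = combination (0# Vector.∷ a) (∷-closed 0-closed a∈K)
      (trans x≈ (sym (trans (+-congʳ (zeroˡ (u zero))) (+-identityˡ _))))

    span-gen : ∀ {n} (u : Vector Carrier n) i → u i ∈ Span u
    span-gen u i = combination (single i 1#) (single-closed i 1-closed)
      (sym (trans (sum-single i 1# u) (*-identityˡ (u i))))

    independent-unique : ∀ {n} {u : Vector Carrier n} → LinearlyIndependent K u →
      ∀ {a b : Vector Carrier n} → (∀ i → a i ∈ K) → (∀ i → b i ∈ K) →
      sum (λ i → a i * u i) ≈ sum (λ i → b i * u i) → ∀ i → a i ≈ b i
    independent-unique {u = u} li {a} {b} a∈K b∈K eq i = x-y≈0⇒x≈y (a i) (b i)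
      (li (λ i → a i + - b i) (λ i → +-closed (a∈K i) (neg-closed (b∈K i))) (begin
        sum (λ i → (a i + - b i) * u i)
          ≈⟨ sum-cong-≋ (λ i → solve 3 (λ a b u → (a :+ (:- b)) :* u := a :* u :+ (:- (b :* u)))
               refl (a i) (b i) (u i)) ⟩
        sum (λ i → a i * u i + - (b i * u i))
          ≈⟨ ∑-distrib-+ (λ i → a i * u i) (λ i → - (b i * u i)) ⟩
        sum (λ i → a i * u i) + sum (λ i → - (b i * u i))
          ≈⟨ +-cong eq (sum-neg (λ i → b i * u i)) ⟩
        sum (λ i → b i * u i) + - sum (λ i → b i * u i)
          ≈⟨ -‿inverseʳ _ ⟩
        0# ∎) i)

    -- A relation with nonzero coefficient at `x` could be solved for `x`, which would then lie in
    -- the span.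
    independent-∷ : ∀ {n} {u : Vector Carrier n} {x} → LinearlyIndependent K u → ¬ (x ∈ Span u) →
                    LinearlyIndependent K (x Vector.∷ u)
    independent-∷ {u = u} {x} li x∉ a a∈K eq with em {a zero ≈ 0#}
    ... | yes a₀≈0 = λ
      { zero    → a₀≈0
      ; (suc i) → li (tail a) (a∈K ∘ suc) (trans (sym (trans (+-congʳ (trans (*-congʳ a₀≈0) (zeroˡ x))) (+-identityˡ _))) eq) i
      }
    ... | no a₀≉0 with inverse a₀≉0
    ...   | y , a₀y≈1 = contradiction (span-resp x≈ (span-* (neg-closed (inv-closed (a∈K zero) a₀y≈1))
                          (combination (tail a) (a∈K ∘ suc) refl))) x∉
      where
      s = sum (λ i → a (suc i) * u i)
      x≈ : - y * s ≈ x
      x≈ = begin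
        - y * s                      ≈⟨ solve 4 (λ y s a x → (:- y) :* s := (a :* y) :* x :+ (:- y) :* (a :* x :+ s))
                                          refl y s (a zero) x ⟩
        (a zero * y) * x + - y * (a zero * x + s)
          ≈⟨ +-cong (trans (*-congʳ a₀y≈1) (*-identityˡ x)) (trans (*-congˡ eq) (zeroʳ (- y))) ⟩
        x + 0#                       ≈⟨ +-identityʳ x ⟩
        x                            ∎

    -- Greedy choice: starting from `w`, each vector outside the span of the previous choices is
    -- added. Keeping `w` itself among the basis vectors allows coefficients to be compared with
    -- those of a multiple of `w`.
    basis-extending : ∀ {w} → ¬ (w ≈ 0#) → ∀ {n} (v : Vector Carrier n) →
      ∃[ r ] Σ (Vector Carrier r) λ u →
        LinearlyIndependent K u × (∃[ i ] u i ≈ w) × (∀ j → v j ∈ Span u)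
    basis-extending {w} w≉0 {zero} v = 1 , (λ _ → w) ,
      (λ { a _ eq zero → xy≈0∧x≉0⇒y≈0 (trans (*-comm w (a zero)) (trans (sym (+-identityʳ _)) eq)) w≉0 }) ,
      (zero , refl) , λ ()
    basis-extending w≉0 {suc n} v with basis-extending w≉0 (tail v)
    ... | r , u , li , (i , uᵢ≈w) , v∈ with em {v zero ∈ Span u}
    ...   | yes v₀∈ = r , u , li , (i , uᵢ≈w) , λ { zero → v₀∈ ; (suc j) → v∈ j }
    ...   | no v₀∉  = suc r , v zero Vector.∷ u , independent-∷ li v₀∉ , (suc i , uᵢ≈w) ,
      λ { zero → span-gen (v zero Vector.∷ u) zero ; (suc j) → span-tail (v zero Vector.∷ u) (v∈ j) }

  generated-isSubfield : ∀ A → IsSubfield (Generated A)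
  generated-isSubfield A = record
    { resp-≈ = resp ; 0-closed = zero ; 1-closed = one ; +-closed = add
    ; neg-closed = neg ; *-closed = mul ; inv-closed = inv }

  generated-least : ∀ {A K} → IsSubfield K → A ⊆ K → Generated A ⊆ K
  generated-least {A} {K} K-isSubfield A⊆K = go
    where
    open IsSubfield K-isSubfield
    go : Generated A ⊆ K
    go (gen x∈A)    = A⊆K x∈A
    go (resp x≈y p) = resp-≈ x≈y (go p)
    go zero         = 0-closed
    go one          = 1-closed
    go (add p q)    = +-closed (go p) (go q)
    go (neg p)      = neg-closed (go p)
    go (mul p q)    = *-closed (go p) (go q)
    go (inv p xy≈1) = inv-closed (go p) xy≈1

  ⟨⟩-least : ∀ {E A K} → IsSubfield K → E ⊆ K → A ⊆ K → E ⟨ A ⟩ ⊆ K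
  ⟨⟩-least K-isSubfield E⊆K A⊆K = generated-least K-isSubfield λ { (inj₁ x∈E) → E⊆K x∈E ; (inj₂ x∈A) → A⊆K x∈A }

  base⊆⟨⟩ : ∀ {E A} → E ⊆ E ⟨ A ⟩
  base⊆⟨⟩ = gen ∘ inj₁

  generators⊆⟨⟩ : ∀ {E A} → A ⊆ E ⟨ A ⟩
  generators⊆⟨⟩ = gen ∘ inj₂

  ⟨⟩-isSubfield : ∀ E A → IsSubfield (E ⟨ A ⟩)
  ⟨⟩-isSubfield E A = generated-isSubfield (E ∪ A)

  ⟨⟩-mono : ∀ {E E′ A A′} → E ⊆ E′ → A ⊆ A′ → E ⟨ A ⟩ ⊆ E′ ⟨ A′ ⟩
  ⟨⟩-mono E⊆E′ A⊆A′ = ⟨⟩-least (⟨⟩-isSubfield _ _) (base⊆⟨⟩ ∘ E⊆E′) (generators⊆⟨⟩ ∘ A⊆A′)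

  whole-isSubfield : IsSubfield Whole
  whole-isSubfield = _

-- Binomial coefficients divisible by a prime.

module PrimeDivisibility where
  open import Data.Nat.Base
  open import Data.Nat.Properties
  open import Data.Nat.Combinatorics using (_C_; nCk≡n!/k![n-k]!; k![n∸k]!∣n!)
  open import Data.Nat.Divisibility
  open import Data.Nat.DivMod using (m/n*n≡m)
  open import Data.Nat.Primality using (euclidsLemma)
  open import Relation.Binary.PropositionalEquality

  prime∤k! : ∀ {p} → Prime p → ∀ k → k < p → p ∤ k !
  prime∤k! {p} pr zero _ p∣1 = contradiction (∣1⇒≡1 p∣1) (≢-sym (<⇒≢ (nonTrivial⇒n>1 p {{prime⇒nonTrivial pr}})))
  prime∤k! pr (suc k) k<p p∣ with euclidsLemma (suc k) (k !) pr p∣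
  ... | inj₁ p∣suck = contradiction (∣⇒≤ p∣suck) (<⇒≱ k<p)
  ... | inj₂ p∣k!   = prime∤k! pr k (<-trans (n<1+n k) k<p) p∣k!

  -- The prime divides `p !`, which is the binomial coefficient times two factorials of numbers
  -- below `p`, and it divides neither factorial.
  prime∣pCk : ∀ {p} → Prime p → ∀ {k} → 0 < k → k < p → p ∣ p C k
  prime∣pCk {p@(suc p-1)} pr {k} 0<k k<p
    with euclidsLemma (p C k) (k ! * (p ∸ k) !) pr (subst (p ∣_) (sym product≡p!) (m∣m*n (p-1 !)))
    where
    instance _ = k !* (p ∸ k) !≢0
    product≡p! : (p C k) * (k ! * (p ∸ k) !) ≡ p !
    product≡p! = trans (cong (_* (k ! * (p ∸ k) !)) (nCk≡n!/k![n-k]! (<⇒≤ k<p)))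
                       (m/n*n≡m (k![n∸k]!∣n! (<⇒≤ k<p)))
  ... | inj₁ p∣pCk = p∣pCk
  ... | inj₂ p∣k!*[p-k]! with euclidsLemma (k !) ((p ∸ k) !) pr p∣k!*[p-k]!
  ...   | inj₁ p∣k!     = contradiction p∣k! (prime∤k! pr k k<p)
  ...   | inj₂ p∣[p-k]! = contradiction p∣[p-k]! (prime∤k! pr (p ∸ k) (∸-monoʳ-< 0<k (<⇒≤ k<p)))
open PrimeDivisibility using (prime∣pCk)

-- Polynomials in one element, and the operators E + y on sequences.

module Powers {ℓ} (F : HeytingField ℓ ℓ ℓ) (em : ExcludedMiddle ℓ) where
  open Over F
  open FieldTheory F em
  open MonoidMult (CommutativeRing.+-monoid ring) public using (×-homo-+; ×-congʳ; ×-congˡ)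
  open SemiringMult semiring public using (×-assoc-*; ×1-homo-*)
  open import Relation.Binary.Reasoning.Setoid setoid

  powers : Carrier → ∀ n → Vector Carrier n
  powers x n i = x ^ toℕ i

  module Polynomial {K : Subset} (K-isSubfield : IsSubfield K) (x : Carrier) where
    open SubfieldProperties K-isSubfield

    -- Values at `x` of polynomials over `K` of degree below `n`; distinct polynomials may have the
    -- same value.
    Poly : ℕ → Subset
    Poly n = Span (powers x n)

    power∈Poly : ∀ {i n} → i ℕ.< n → (x ^ i) ∈ Poly n
    power∈Poly {i} {n} i<n = span-resp (reflexive (≡.cong (x ^_) (Fin.toℕ-fromℕ< i<n)))
      (span-gen (powers x n) (fromℕ< i<n))

    constant∈Poly : ∀ {k n} → 0 ℕ.< n → k ∈ K → k ∈ Poly n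
    constant∈Poly {k} 0<n k∈K = span-resp (*-identityʳ k) (span-* k∈K (power∈Poly 0<n))

    poly-mono : ∀ {m n} → m ℕ.≤ n → Poly m ⊆ Poly n
    poly-mono m≤n = span-trans (λ i → power∈Poly (ℕ.<-≤-trans (Fin.toℕ<n i) m≤n))

    x*-poly : ∀ {n y} → y ∈ Poly n → (x * y) ∈ Poly (suc n)
    x*-poly {n} (combination a a∈K y≈) = span-resp
      (sym (trans (*-congˡ y≈) (trans (*-distribˡ-sum x (λ i → a i * x ^ toℕ i))
        (sum-cong-≋ (λ i → solve 3 (λ x a y → x :* (a :* y) := a :* (x :* y)) refl x (a i) (x ^ toℕ i))))))
      (span-sum (λ i → span-* (a∈K i) (power∈Poly (s≤s (Fin.toℕ<n i)))))

    poly-reduce : ∀ {n} → (x ^ n) ∈ Poly n → Poly (suc n) ⊆ Poly n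
    poly-reduce {n} xⁿ∈ = span-trans λ i → power (ℕ.m<1+n⇒m<n∨m≡n (Fin.toℕ<n i))
      where
      power : ∀ {i} → i ℕ.< n ⊎ i ≡ n → (x ^ i) ∈ Poly n
      power (inj₁ i<n)    = power∈Poly i<n
      power (inj₂ ≡.refl) = xⁿ∈

    -- Products are linear in `y`, so only the powers of `x` have to be tested.
    *-poly : ∀ {m y z n} → (∀ i → i ℕ.< m → (x ^ i * z) ∈ Poly n) →
             y ∈ Poly m → (y * z) ∈ Poly n
    *-poly {m} {y} {z} xⁱz∈ (combination a a∈K y≈) = span-resp
      (sym (trans (*-congʳ y≈) (trans (*-distribʳ-sum z (λ i → a i * x ^ toℕ i))
        (sum-cong-≋ (λ i → *-assoc (a i) (x ^ toℕ i) z)))))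
      (span-sum (λ i → span-* (a∈K i) (xⁱz∈ (toℕ i) (Fin.toℕ<n i))))

    power*-poly : ∀ {n z} → z ∈ Poly n → ∀ i → (x ^ i * z) ∈ Poly (i ℕ.+ n)
    power*-poly {z = z} z∈ zero    = span-resp (sym (*-identityˡ z)) z∈
    power*-poly {z = z} z∈ (suc i) = span-resp (sym (*-assoc x (x ^ i) z)) (x*-poly (power*-poly z∈ i))

    *-poly-+ : ∀ {m n y z} → y ∈ Poly m → z ∈ Poly n → (y * z) ∈ Poly (m ℕ.+ n)
    *-poly-+ {m} {n} y∈ z∈ = *-poly (λ i i<m → poly-mono (ℕ.+-monoˡ-≤ n (ℕ.<⇒≤ i<m)) (power*-poly z∈ i)) y∈

    -- A monic relation of degree `n` for `x` over `K` makes `Poly n` stable under multiplication by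
    -- `x`, so that it is the whole ring K[x].
    module Reduced {n} (xⁿ∈ : (x ^ n) ∈ Poly n) where
      reduced-x* : ∀ {y} → y ∈ Poly n → (x * y) ∈ Poly n
      reduced-x* y∈ = poly-reduce xⁿ∈ (x*-poly y∈)

      reduced-power* : ∀ {z} → z ∈ Poly n → ∀ i → (x ^ i * z) ∈ Poly n
      reduced-power* {z} z∈ zero    = span-resp (sym (*-identityˡ z)) z∈
      reduced-power* {z} z∈ (suc i) = span-resp (sym (*-assoc x (x ^ i) z)) (reduced-x* (reduced-power* z∈ i))

      reduced-* : ∀ {y z} → y ∈ Poly n → z ∈ Poly n → (y * z) ∈ Poly n
      reduced-* y∈ z∈ = *-poly (λ i _ → reduced-power* z∈ i) y∈

  -- δ y j f n is (E + y)^j f evaluated at n, where E is the shift of sequences.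
  δ : Carrier → ℕ → (ℕ → Carrier) → ℕ → Carrier
  δ y zero    f n = f n
  δ y (suc j) f n = δ y j f (suc n) + y * δ y j f n

  sum-last : ∀ m (h : ℕ → Carrier) → (∀ i → i ℕ.< m → h i ≈ 0#) →
             sum {suc m} (λ i → h (toℕ i)) ≈ h m
  sum-last zero    h _   = +-identityʳ (h 0)
  sum-last (suc m) h h≈0 = trans (+-cong (h≈0 0 z<s) (sum-last m (h ∘ suc) (λ i i<m → h≈0 (suc i) (s≤s i<m))))
                                 (+-identityˡ (h (suc m)))

  -- The binomial expansion of (E + 1)ʲ, by Pascal's rule. Coefficients beyond j vanish, so the
  -- bound `N` is free; the induction step uses the hypothesis with two different bounds.
  δ₁-binomial : ∀ g j N → j ℕ.< N → ∀ n →
                δ 1# j g n ≈ sum {N} (λ i → (j choose toℕ i) · g (n ℕ.+ toℕ i))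
  δ₁-binomial g zero (suc N) _ n = begin
    g n                            ≈⟨ reflexive (≡.cong g (ℕ.+-identityʳ n)) ⟨
    g (n ℕ.+ 0)                    ≈⟨ +-identityʳ _ ⟨
    1 · g (n ℕ.+ 0)                ≈⟨ +-identityʳ _ ⟨
    1 · g (n ℕ.+ 0) + 0#
      ≈⟨ +-congˡ (sum-zero {N} (λ i → ×-congˡ {g (n ℕ.+ suc (toℕ i))} (k>n⇒nCk≡0 {0} {suc (toℕ i)} z<s))) ⟨
    sum {suc N} (λ i → (0 choose toℕ i) · g (n ℕ.+ toℕ i)) ∎
  δ₁-binomial g (suc j) (suc N) (s≤s j<N) n = begin
    δ 1# j g (suc n) + 1# * δ 1# j g n
      ≈⟨ +-cong (δ₁-binomial g j N j<N (suc n)) (trans (*-identityˡ _) (δ₁-binomial g j (suc N) (ℕ.m<n⇒m<1+n j<N) n)) ⟩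
    A + (h₀ + B)
      ≈⟨ solve 3 (λ a h b → a :+ (h :+ b) := h :+ (a :+ b)) refl A h₀ B ⟩
    h₀ + (A + B)
      ≈⟨ +-congˡ (∑-distrib-+ {N} (λ i → (j choose toℕ i) · g (suc n ℕ.+ toℕ i)) (λ i → (j choose suc (toℕ i)) · g (n ℕ.+ suc (toℕ i)))) ⟨
    h₀ + sum {N} (λ i → (j choose toℕ i) · g (suc n ℕ.+ toℕ i) + (j choose suc (toℕ i)) · g (n ℕ.+ suc (toℕ i)))
      ≈⟨ +-congˡ (sum-cong-≋ {N} pascal) ⟩
    sum {suc N} (λ i → (suc j choose toℕ i) · g (n ℕ.+ toℕ i)) ∎
    where
    A = sum {N} (λ i → (j choose toℕ i) · g (suc n ℕ.+ toℕ i))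
    B = sum {N} (λ i → (j choose suc (toℕ i)) · g (n ℕ.+ suc (toℕ i)))
    h₀ = (j choose 0) · g (n ℕ.+ 0)
    pascal : ∀ (i : Fin N) → (j choose toℕ i) · g (suc n ℕ.+ toℕ i) + (j choose suc (toℕ i)) · g (n ℕ.+ suc (toℕ i)) ≈
                   (suc j choose suc (toℕ i)) · g (n ℕ.+ suc (toℕ i))
    pascal i = begin
      (j choose toℕ i) · g (suc n ℕ.+ toℕ i) + (j choose suc (toℕ i)) · g (n ℕ.+ suc (toℕ i))
        ≈⟨ +-congʳ (×-congʳ (j choose toℕ i) (reflexive (≡.cong g (ℕ.+-suc n (toℕ i))))) ⟨
      (j choose toℕ i) · g (n ℕ.+ suc (toℕ i)) + (j choose suc (toℕ i)) · g (n ℕ.+ suc (toℕ i))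
        ≈⟨ ×-homo-+ (g (n ℕ.+ suc (toℕ i))) (j choose toℕ i) (j choose suc (toℕ i)) ⟨
      ((j choose toℕ i) ℕ.+ (j choose suc (toℕ i))) · g (n ℕ.+ suc (toℕ i))
        ≈⟨ ×-congˡ (nCk+nC[k+1]≡[n+1]C[k+1] j (toℕ i)) ⟩
      (suc j choose suc (toℕ i)) · g (n ℕ.+ suc (toℕ i)) ∎

  -- A geometric sequence is an eigenvector of E with eigenvalue its ratio.
  δ-powers : ∀ x y j n → δ y j (x ^_) n ≈ (x + y) ^ j * x ^ n
  δ-powers x y zero    n = sym (*-identityˡ (x ^ n))
  δ-powers x y (suc j) n = begin
    δ y j (x ^_) (suc n) + y * δ y j (x ^_) n
      ≈⟨ +-cong (δ-powers x y j (suc n)) (*-congˡ (δ-powers x y j n)) ⟩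
    (x + y) ^ j * (x * x ^ n) + y * ((x + y) ^ j * x ^ n)
      ≈⟨ solve 4 (λ x y s t → s :* (x :* t) :+ y :* (s :* t) := (x :+ y) :* s :* t)
           refl x y ((x + y) ^ j) (x ^ n) ⟩
    (x + y) ^ suc j * x ^ n ∎

  -- Writing f n = yⁿ g n turns E + y into y (E + 1), which reduces everything to the shift constant
  -- 1.
  δ-rescale : ∀ {y z} → y * z ≈ 1# → ∀ f j n → δ y j f n ≈ y ^ (j ℕ.+ n) * δ 1# j (λ i → z ^ i * f i) n
  δ-rescale {y} {z} yz≈1 f zero n = begin
    f n                        ≈⟨ *-identityˡ (f n) ⟨
    1# * f n                   ≈⟨ *-congʳ (trans (^-congˡ n yz≈1) (1^n≈1 n)) ⟨
    (y * z) ^ n * f n          ≈⟨ *-congʳ (^-distrib-* y z n) ⟩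
    y ^ n * z ^ n * f n        ≈⟨ *-assoc (y ^ n) (z ^ n) (f n) ⟩
    y ^ n * (z ^ n * f n)      ∎
  δ-rescale {y} {z} yz≈1 f (suc j) n = begin
    δ y j f (suc n) + y * δ y j f n
      ≈⟨ +-cong (δ-rescale yz≈1 f j (suc n)) (*-congˡ (δ-rescale yz≈1 f j n)) ⟩
    y ^ (j ℕ.+ suc n) * δ 1# j g (suc n) + y * (y ^ (j ℕ.+ n) * δ 1# j g n)
      ≈⟨ +-congʳ (*-congʳ (reflexive (≡.cong (y ^_) (ℕ.+-suc j n)))) ⟩
    y * y ^ (j ℕ.+ n) * δ 1# j g (suc n) + y * (y ^ (j ℕ.+ n) * δ 1# j g n)
      ≈⟨ solve 4 (λ y s a b → y :* s :* a :+ y :* (s :* b) := y :* s :* (a :+ con (1 , 0) :* b)) refl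
           y (y ^ (j ℕ.+ n)) (δ 1# j g (suc n)) (δ 1# j g n) ⟩
    y ^ (suc j ℕ.+ n) * δ 1# (suc j) g n ∎
    where
    g : ℕ → Carrier
    g i = z ^ i * f i

  -- Positive characteristic: primality of p, the p-th power of E + y, and Frobenius.

  module Characteristic {p} (p≢0 : p ≢ 0) (char : IsCharacteristic p) where

    p·1≈0 : p · 1# ≈ 0#
    p·1≈0 = Equivalence.from (char p) ∣-refl

    ·≈·1* : ∀ n x → n · x ≈ (n · 1#) * x
    ·≈·1* n x = sym (trans (×-assoc-* n 1# x) (×-congʳ n (*-identityˡ x)))

    n·x≈0⇒x≈0 : ∀ {n x} → 0 ℕ.< n → n ℕ.< p → n · x ≈ 0# → x ≈ 0#
    n·x≈0⇒x≈0 {n@(suc _)} {x} 0<n n<p nx≈0 = xy≈0∧x≉0⇒y≈0 (trans (sym (·≈·1* n x)) nx≈0)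
      (λ n1≈0 → ℕ.<⇒≱ n<p (∣⇒≤ (Equivalence.to (char n) n1≈0)))

    p∣n⇒n·x≈0 : ∀ {n} x → p ∣ n → n · x ≈ 0#
    p∣n⇒n·x≈0 {n} x p∣n = trans (·≈·1* n x) (trans (*-congʳ (Equivalence.from (char n) p∣n)) (zeroˡ x))

    -- If p = q d, then (q · 1)(d · 1) = 0, so one factor vanishes and p divides d or q.
    p-prime : Prime p
    p-prime = irreducible⇒prime {{nontrivial p≢0 char}} irreducible
      where
      nontrivial : ∀ {p} → p ≢ 0 → IsCharacteristic p → ℕ.NonTrivial p
      nontrivial {0} p≢0 _ = contradiction ≡.refl p≢0
      nontrivial {1} _ char = contradiction (trans (sym (+-identityʳ 1#)) (Equivalence.from (char 1) ∣-refl)) 1≉0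
      nontrivial {suc (suc _)} _ _ = _
      irreducible : ∀ {d} → d ∣ p → d ≡ 1 ⊎ d ≡ p
      irreducible {d} d∣p@(divides q p≡qd) with em {d · 1# ≈ 0#}
      ... | yes d1≈0 = inj₂ (ℕ.≤-antisym (∣⇒≤ {{ℕ.≢-nonZero p≢0}} d∣p)
                          (∣⇒≤ {{ℕ.≢-nonZero d≢0}} (Equivalence.to (char d) d1≈0)))
        where
        d≢0 : d ≢ 0
        d≢0 ≡.refl = p≢0 (≡.trans p≡qd (ℕ.*-zeroʳ q))
      ... | no d1≉0 with Equivalence.to (char q) (xy≈0∧x≉0⇒y≈0
                (trans (*-comm (d · 1#) (q · 1#)) (trans (sym (×1-homo-* q d)) (trans (×-congˡ (≡.sym p≡qd)) p·1≈0))) d1≉0)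
      ...   | divides r q≡rp = inj₁ (∣1⇒≡1 (divides r (≡.sym (ℕ.*-cancelʳ-≡ (r ℕ.* d) 1 p {{ℕ.≢-nonZero p≢0}}
                (≡.trans (≡.cong (ℕ._* p) (ℕ.*-comm r d)) (≡.trans (ℕ.*-assoc d r p) (≡.trans (≡.cong (d ℕ.*_) (≡.sym q≡rp))
                (≡.trans (ℕ.*-comm d q) (≡.trans (≡.sym p≡qd) (≡.sym (ℕ.*-identityˡ p))))))))))) 

    1<p : 1 ℕ.< p
    1<p = ℕ.nonTrivial⇒n>1 p {{prime⇒nonTrivial p-prime}}

    0<p : 0 ℕ.< p
    0<p = ℕ.<⇒≤ 1<p

    0^p≈0 : 0# ^ p ≈ 0#
    0^p≈0 = lemma p≢0
      where
      lemma : ∀ {n} → n ≢ 0 → 0# ^ n ≈ 0#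
      lemma {zero}  n≢0 = contradiction ≡.refl n≢0
      lemma {suc n} _   = zeroˡ _

    -- All inner binomial coefficients are divisible by p, hence (E + 1)ᵖ = 1 + Eᵖ.
    δ₁-p : ∀ g n → δ 1# p g n ≈ g n + g (n ℕ.+ p)
    δ₁-p g n = trans (δ₁-binomial g p (suc p) ℕ.≤-refl n)
      (+-cong (trans (+-identityʳ _) (reflexive (≡.cong g (ℕ.+-identityʳ n)))) (top p p≢0 ≡.refl))
      where
      h : ℕ → Carrier
      h i = (p choose suc i) · g (n ℕ.+ suc i)
      -- The length of the sum becomes a variable, since the module parameter `p` cannot be matched
      -- against a successor to isolate the last summand.
      top : ∀ q → q ≢ 0 → q ≡ p → sum {q} (λ i → h (toℕ i)) ≈ g (n ℕ.+ p)
      top zero    q≢0 _      = contradiction ≡.refl q≢0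
      top (suc q) _   sucq≡p = trans
        (sum-last q h (λ i i<q → p∣n⇒n·x≈0 (g (n ℕ.+ suc i)) (prime∣pCk p-prime z<s (ℕ.<-≤-trans (s≤s i<q) (ℕ.≤-reflexive sucq≡p)))))
        (trans (reflexive (≡.cong (λ m → (p choose m) · g (n ℕ.+ m)) sucq≡p))
          (trans (×-congˡ (nCn≡1 p)) (+-identityʳ (g (n ℕ.+ p)))))

    δ-p : ∀ {y} → ¬ (y ≈ 0#) → ∀ f n → δ y p f n ≈ y ^ p * f n + f (n ℕ.+ p)
    δ-p {y} y≉0 f n with inverse y≉0
    ... | z , yz≈1 = begin
      δ y p f n
        ≈⟨ δ-rescale yz≈1 f p n ⟩
      y ^ (p ℕ.+ n) * δ 1# p (λ i → z ^ i * f i) n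
        ≈⟨ *-congˡ (δ₁-p (λ i → z ^ i * f i) n) ⟩
      y ^ (p ℕ.+ n) * (z ^ n * f n + z ^ (n ℕ.+ p) * f (n ℕ.+ p))
        ≈⟨ distribˡ (y ^ (p ℕ.+ n)) _ _ ⟩
      y ^ (p ℕ.+ n) * (z ^ n * f n) + y ^ (p ℕ.+ n) * (z ^ (n ℕ.+ p) * f (n ℕ.+ p))
        ≈⟨ +-cong
             (trans (*-congʳ (^-homo-* y p n)) (trans
               (solve 4 (λ a b c d → (a :* b) :* (c :* d) := (b :* c) :* (a :* d)) refl (y ^ p) (y ^ n) (z ^ n) (f n))
               (trans (*-congʳ (cancel n)) (*-identityˡ _))))
             (trans (*-congʳ (reflexive (≡.cong (y ^_) (ℕ.+-comm p n))))
               (trans (sym (*-assoc _ _ _)) (trans (*-congʳ (cancel (n ℕ.+ p))) (*-identityˡ _)))) ⟩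
      y ^ p * f n + f (n ℕ.+ p) ∎
      where
      cancel : ∀ m → y ^ m * z ^ m ≈ 1#
      cancel m = trans (sym (^-distrib-* y z m)) (trans (^-congˡ m yz≈1) (1^n≈1 m))

    -- Evaluate (E + y)ᵖ = Eᵖ + yᵖ at 0 on the sequence of powers of `x`: the left side acts as (x +
    -- y)ᵖ. The case y = 0 is separate because `δ-p` rescales by 1/y.
    frobenius-+ : ∀ x y → (x + y) ^ p ≈ x ^ p + y ^ p
    frobenius-+ x y with em {y ≈ 0#}
    ... | yes y≈0 = trans (^-congˡ p (trans (+-congˡ y≈0) (+-identityʳ x)))
                      (sym (trans (+-congˡ (trans (^-congˡ p y≈0) 0^p≈0)) (+-identityʳ (x ^ p))))
    ... | no y≉0  = begin
      (x + y) ^ p                   ≈⟨ *-identityʳ _ ⟨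
      (x + y) ^ p * 1#              ≈⟨ δ-powers x y p 0 ⟨
      δ y p (x ^_) 0                ≈⟨ δ-p y≉0 (x ^_) 0 ⟩
      y ^ p * 1# + x ^ p            ≈⟨ trans (+-comm _ _) (+-congˡ (*-identityʳ _)) ⟩
      x ^ p + y ^ p                 ∎

    frobenius-neg : ∀ x → (- x) ^ p ≈ - (x ^ p)
    frobenius-neg x = begin
      (- x) ^ p                        ≈⟨ solve 2 (λ a b → a := (b :+ a) :+ (:- b)) refl ((- x) ^ p) (x ^ p) ⟩
      (x ^ p + (- x) ^ p) + - (x ^ p)  ≈⟨ +-congʳ (frobenius-+ x (- x)) ⟨
      (x + - x) ^ p + - (x ^ p)        ≈⟨ +-congʳ (trans (^-congˡ p (-‿inverseʳ x)) 0^p≈0) ⟩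
      0# + - (x ^ p)                   ≈⟨ +-identityˡ _ ⟩
      - (x ^ p)                        ∎

    frobenius-injective : ∀ {x y} → x ^ p ≈ y ^ p → x ≈ y
    frobenius-injective {x} {y} xᵖ≈yᵖ = x-y≈0⇒x≈y x y (x^n≈0⇒x≈0 p (begin
      (x + - y) ^ p       ≈⟨ frobenius-+ x (- y) ⟩
      x ^ p + (- y) ^ p   ≈⟨ +-cong xᵖ≈yᵖ (frobenius-neg y) ⟩
      y ^ p + - (y ^ p)   ≈⟨ -‿inverseʳ _ ⟩
      0#                  ∎))

    frobenius-sum : ∀ {n} (f : Vector Carrier n) → sum f ^ p ≈ sum (λ i → f i ^ p)
    frobenius-sum {zero}  f = 0^p≈0
    frobenius-sum {suc n} f = trans (frobenius-+ (f zero) (sum (tail f))) (+-congˡ (frobenius-sum (tail f)))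

    ^p-isSubfield : ∀ {K} → IsSubfield K → IsSubfield (K ^⦅ p ⦆)
    ^p-isSubfield {K} K-isSubfield = record
      { resp-≈     = λ { x≈y (z , z∈K , x≈) → z , z∈K , trans (sym x≈y) x≈ }
      ; 0-closed   = 0# , 0-closed , sym 0^p≈0
      ; 1-closed   = 1# , 1-closed , sym (1^n≈1 p)
      ; +-closed   = λ { (x′ , x∈ , x≈) (y′ , y∈ , y≈) → x′ + y′ , +-closed x∈ y∈ , trans (+-cong x≈ y≈) (sym (frobenius-+ x′ y′)) }
      ; neg-closed = λ { (x′ , x∈ , x≈) → - x′ , neg-closed x∈ , trans (-‿cong x≈) (sym (frobenius-neg x′)) }
      ; *-closed   = λ { (x′ , x∈ , x≈) (y′ , y∈ , y≈) → x′ * y′ , *-closed x∈ y∈ , trans (*-cong x≈ y≈) (sym (^-distrib-* x′ y′ p)) }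
      ; inv-closed = λ { {x} {y} (x′ , x∈ , x≈) xy≈1 → inv-^p x∈ x≈ xy≈1 }
      }
      where
      open IsSubfield K-isSubfield
      inv-^p : ∀ {x′ x y} → x′ ∈ K → x ≈ x′ ^ p → x * y ≈ 1# → ∃[ y′ ] y′ ∈ K × y ≈ y′ ^ p
      inv-^p {x′} {x} {y} x∈ x≈ xy≈1 with inverse {x′} (λ x′≈0 → 1≉0 (trans (sym xy≈1)
        (trans (*-congʳ (trans x≈ (trans (^-congˡ p x′≈0) 0^p≈0))) (zeroˡ y))))
      ... | y′ , x′y′≈1 = y′ , inv-closed x∈ x′y′≈1 , (begin
        y                        ≈⟨ *-identityʳ y ⟨
        y * 1#                   ≈⟨ *-congˡ (trans (^-congˡ p x′y′≈1) (1^n≈1 p)) ⟨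
        y * (x′ * y′) ^ p        ≈⟨ *-congˡ (^-distrib-* x′ y′ p) ⟩
        y * (x′ ^ p * y′ ^ p)    ≈⟨ *-assoc y _ _ ⟨
        y * x′ ^ p * y′ ^ p      ≈⟨ *-congʳ (trans (*-comm y _) (trans (*-congʳ (sym x≈)) xy≈1)) ⟩
        1# * y′ ^ p              ≈⟨ *-identityˡ _ ⟩
        y′ ^ p                   ∎)

-- The operator b d/db, and independence of the powers of b when bᵖ lies in K but b does not.

module PIndependence {ℓ} (F : HeytingField ℓ ℓ ℓ) (em : ExcludedMiddle ℓ) where
  open Over F
  open FieldTheory F em
  open Powers F em
  open import Relation.Binary.Reasoning.Setoid setoid

  -- The search runs downwards and stops at the first failure, at 1 at the latest. The failure has a
  -- positive index `suc j`, so that one power of E - b fewer can still be applied.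
  last-failure : ∀ (P : ℕ → Set ℓ) k → ¬ P 1 → P (suc k) → ∃[ j ] ¬ P (suc j) × P (suc (suc j))
  last-failure P zero    ¬P1 P1 = contradiction P1 ¬P1
  last-failure P (suc k) ¬P1 Pk with em {P (suc k)}
  ... | yes P[k-1] = last-failure P k ¬P1 P[k-1]
  ... | no ¬P[k-1] = k , ¬P[k-1] , Pk

  module Independence {p} (p≢0 : p ≢ 0) (char : IsCharacteristic p) where
    open Characteristic p≢0 char public

    -- A sequence t with these properties is annihilated by (E − b)ᵖ but not by E − b,
    -- where E is the shift.  Hence some (E − b)ʲ maps it to a sequence w which is
    -- annihilated by (E − b)² but not by E − b; then b * w n = bⁿ (c + n μ) with μ ≠ 0,
    -- and w satisfies every linear recurrence satisfied by t.
    module NonGeometricSequence {b} (b≉0 : ¬ (b ≈ 0#)) (t : ℕ → Carrier)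
             (periodic : ∀ n → t (n ℕ.+ p) ≈ b ^ p * t n) (t₁≉bt₀ : ¬ (t 1 ≈ b * t 0)) where

      abstract
        -- By `δ-p`, (E - b)ᵖ is Eᵖ - bᵖ, and `periodic` says that this kills `t`.
        δₚ≈0 : ∀ n → δ (- b) p t n ≈ 0#
        δₚ≈0 n = begin
          δ (- b) p t n
            ≈⟨ δ-p (λ -b≈0 → b≉0 (trans (sym (-‿involutive b)) (trans (-‿cong -b≈0) -0#≈0#))) t n ⟩
          (- b) ^ p * t n + t (n ℕ.+ p)       ≈⟨ +-cong (*-congʳ (frobenius-neg b)) (periodic n) ⟩
          - (b ^ p) * t n + b ^ p * t n       ≈⟨ solve 2 (λ x y → (:- x) :* y :+ x :* y := con (0 , 0))
                                                   refl (b ^ p) (t n) ⟩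
          0#                                  ∎

        almost-annihilated : ∃[ j ] ¬ (∀ n → δ (- b) (suc j) t n ≈ 0#) × (∀ n → δ (- b) (suc (suc j)) t n ≈ 0#)
        almost-annihilated = last-failure (λ j → ∀ n → δ (- b) j t n ≈ 0#) (ℕ.pred p)
          (λ δ₁≈0 → t₁≉bt₀ (x-y≈0⇒x≈y (t 1) (b * t 0) (trans (+-congˡ (-‿distribˡ-* b (t 0))) (δ₁≈0 0))))
          (≡.subst (λ q → ∀ n → δ (- b) q t n ≈ 0#) (≡.sym (ℕ.suc-pred p {{ℕ.≢-nonZero p≢0}})) δₚ≈0)

      module _ {n} (a : Vector Carrier n) (t-relation : ∀ m → sum (λ i → a i * t (m ℕ.+ toℕ i)) ≈ 0#) where
        -- The coefficients are constant, so a recurrence that holds at every position is preserved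
        -- by E - b.
        δ-relation : ∀ j m → sum (λ i → a i * δ (- b) j t (m ℕ.+ toℕ i)) ≈ 0#
        δ-relation zero    m = t-relation m
        δ-relation (suc j) m = begin
          sum (λ i → a i * (x i + - b * y i))
            ≈⟨ sum-cong-≋ (λ i → solve 4 (λ a x b y → a :* (x :+ b :* y) := a :* x :+ b :* (a :* y)) refl
                 (a i) (x i) (- b) (y i)) ⟩
          sum (λ i → a i * x i + - b * (a i * y i))
            ≈⟨ ∑-distrib-+ (λ i → a i * x i) (λ i → - b * (a i * y i)) ⟩
          sum (λ i → a i * x i) + sum (λ i → - b * (a i * y i))
            ≈⟨ +-cong (δ-relation j (suc m)) (trans (sym (*-distribˡ-sum (- b) (λ i → a i * y i)))
                 (trans (*-congˡ (δ-relation j m)) (zeroʳ (- b)))) ⟩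
          0# + 0#
            ≈⟨ +-identityʳ 0# ⟩
          0# ∎
          where
          x y : Vector Carrier n
          x i = δ (- b) j t (suc m ℕ.+ toℕ i)
          y i = δ (- b) j t (m ℕ.+ toℕ i)

    module AlmostGeometricSequence {b} (w v : ℕ → Carrier)
             (w-suc : ∀ n → w (suc n) ≈ v n + b * w n) (v-suc : ∀ n → v (suc n) ≈ b * v n) where

      v-geometric : ∀ n → v n ≈ b ^ n * v 0
      v-geometric zero    = sym (*-identityˡ (v 0))
      v-geometric (suc n) = trans (v-suc n) (trans (*-congˡ (v-geometric n)) (sym (*-assoc b (b ^ n) (v 0))))

      w-form : ∀ n → b * w n ≈ b ^ n * (b * w 0 + n · v 0)
      w-form zero    = sym (trans (*-identityˡ _) (+-identityʳ _))
      w-form (suc n) = begin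
        b * w (suc n)
          ≈⟨ *-congˡ (trans (w-suc n) (+-cong (v-geometric n) (w-form n))) ⟩
        b * (b ^ n * v 0 + b ^ n * (b * w 0 + n · v 0))
          ≈⟨ solve 5 (λ b s v c d → b :* (s :* v :+ s :* (c :+ d)) := b :* s :* (c :+ (v :+ d))) refl
               b (b ^ n) (v 0) (b * w 0) (n · v 0) ⟩
        b ^ suc n * (b * w 0 + suc n · v 0) ∎

      -- Multiply the recurrence for `w` by b and insert `w-form`: it splits into `b * w 0` times
      -- the relation between the powers of b, which is zero, and `v 0` times the differentiated
      -- relation.
      v₀* : ∀ {n} (a : Vector Carrier n) → sum (λ i → a i * b ^ toℕ i) ≈ 0# →
            sum (λ i → a i * w (toℕ i)) ≈ 0# → v 0 * sum (λ i → (toℕ i · a i) * b ^ toℕ i) ≈ 0#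
      v₀* {n} a eq w-relation = begin
        v 0 * sum (λ i → (toℕ i · a i) * b ^ toℕ i)
          ≈⟨ *-distribˡ-sum (v 0) (λ i → (toℕ i · a i) * b ^ toℕ i) ⟩
        sum e
          ≈⟨ +-identityˡ _ ⟨
        0# + sum e
          ≈⟨ +-congʳ (trans (*-congˡ eq) (zeroʳ (b * w 0))) ⟨
        b * w 0 * sum (λ i → a i * b ^ toℕ i) + sum e
          ≈⟨ +-congʳ (*-distribˡ-sum (b * w 0) (λ i → a i * b ^ toℕ i)) ⟩
        sum (λ i → b * w 0 * (a i * b ^ toℕ i)) + sum e
          ≈⟨ ∑-distrib-+ (λ i → b * w 0 * (a i * b ^ toℕ i)) e ⟨
        sum (λ i → b * w 0 * (a i * b ^ toℕ i) + e i)
          ≈⟨ sum-cong-≋ term ⟩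
        sum (λ i → b * (a i * w (toℕ i)))
          ≈⟨ *-distribˡ-sum b (λ i → a i * w (toℕ i)) ⟨
        b * sum (λ i → a i * w (toℕ i))
          ≈⟨ trans (*-congˡ w-relation) (zeroʳ b) ⟩
        0# ∎
        where
        e : Vector Carrier n
        e i = v 0 * ((toℕ i · a i) * b ^ toℕ i)

        term : ∀ i → b * w 0 * (a i * b ^ toℕ i) + e i ≈ b * (a i * w (toℕ i))
        term i = begin
          b * w 0 * (a i * b ^ toℕ i) + v 0 * ((toℕ i · a i) * b ^ toℕ i)
            ≈⟨ +-congˡ (*-congˡ (*-congʳ (·≈·1* (toℕ i) (a i)))) ⟩
          b * w 0 * (a i * b ^ toℕ i) + v 0 * ((toℕ i · 1#) * a i * b ^ toℕ i)
            ≈⟨ solve 5 (λ c a s v k → c :* (a :* s) :+ v :* (k :* a :* s) := a :* (s :* (c :+ k :* v))) refl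
                 (b * w 0) (a i) (b ^ toℕ i) (v 0) (toℕ i · 1#) ⟩
          a i * (b ^ toℕ i * (b * w 0 + (toℕ i · 1#) * v 0))
            ≈⟨ *-congˡ (*-congˡ (+-congˡ (·≈·1* (toℕ i) (v 0)))) ⟨
          a i * (b ^ toℕ i * (b * w 0 + toℕ i · v 0))
            ≈⟨ *-congˡ (w-form (toℕ i)) ⟨
          a i * (b * w (toℕ i))
            ≈⟨ solve 3 (λ a b w → a :* (b :* w) := b :* (a :* w)) refl (a i) b (w (toℕ i)) ⟩
          b * (a i * w (toℕ i)) ∎

    sequence-euler : ∀ {b} → ¬ (b ≈ 0#) → (t : ℕ → Carrier) →
      (∀ n → t (n ℕ.+ p) ≈ b ^ p * t n) → ¬ (t 1 ≈ b * t 0) →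
      ∀ {n} (a : Vector Carrier n) → (∀ m → sum (λ i → a i * t (m ℕ.+ toℕ i)) ≈ 0#) →
      sum (λ i → a i * b ^ toℕ i) ≈ 0# → sum (λ i → (toℕ i · a i) * b ^ toℕ i) ≈ 0#
    sequence-euler {b} b≉0 t periodic t₁≉bt₀ a t-relation eq = xy≈0∧x≉0⇒y≈0 (v₀* a eq (δ-relation a t-relation j 0)) v₀≉0
      where
      open NonGeometricSequence b≉0 t periodic t₁≉bt₀
      j = proj₁ almost-annihilated
      w = δ (- b) j t
      v = δ (- b) (suc j) t
      rearrange : ∀ {x y z} → x + - b * y ≈ z → x ≈ z + b * y
      rearrange {x} {y} {z} e = trans (solve 3 (λ x b y → x := (x :+ (:- b) :* y) :+ b :* y) refl x b y) (+-congʳ e)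
      open AlmostGeometricSequence {b} w v (λ n → rearrange refl)
        (λ n → trans (rearrange (proj₂ (proj₂ almost-annihilated) n)) (+-identityˡ _))
      -- As `v` is geometric, it would vanish everywhere if it vanished at 0, against the choice of
      -- `j`.
      v₀≉0 : ¬ (v 0 ≈ 0#)
      v₀≉0 v₀≈0 = proj₁ (proj₂ almost-annihilated) (λ n → trans (v-geometric n) (trans (*-congˡ v₀≈0) (zeroʳ (b ^ n))))

    module Simple {K : Subset} (K-isSubfield : IsSubfield K)
                  {b : Carrier} (bᵖ∈K : (b ^ p) ∈ K) (b∉K : ¬ (b ∈ K)) where
      open SubfieldProperties K-isSubfield
      open Polynomial K-isSubfield b

      b≉0 : ¬ (b ≈ 0#)
      b≉0 b≈0 = b∉K (resp-≈ (sym b≈0) 0-closed)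

      bⁿ∈Poly : ∀ n → (b ^ n) ∈ Poly p
      bⁿ∈Poly n = span-resp (*-identityʳ (b ^ n))
        (Reduced.reduced-power* (constant∈Poly 0<p bᵖ∈K) (constant∈Poly 0<p 1-closed) n)

      -- Here `t h n` is the coordinate of bⁿ at `u h`. Independence holds over `K` only, so
      -- coordinates may be compared only when all coefficients lie in `K`; the assumption bᵖ ∈ K is
      -- what makes bᵖ a scalar in `t-periodic`.
      module Coordinates {r} {u : Vector Carrier r} (u-independent : LinearlyIndependent K u)
                         (coordinates : ∀ n → (b ^ n) ∈ Span u) where

        t : Fin r → ℕ → Carrier
        t h n = Span.coefficient (coordinates n) h

        t∈K : ∀ h n → t h n ∈ K
        t∈K h n = Span.coefficient∈K (coordinates n) h

        t-expansion : ∀ n → b ^ n ≈ sum (λ h → t h n * u h)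
        t-expansion n = Span.expansion (coordinates n)

        t-periodic : ∀ h n → t h (n ℕ.+ p) ≈ b ^ p * t h n
        t-periodic h n = independent-unique u-independent
          (λ h → t∈K h (n ℕ.+ p)) (λ h → *-closed bᵖ∈K (t∈K h n))
          (begin
            sum (λ h → t h (n ℕ.+ p) * u h)   ≈⟨ t-expansion (n ℕ.+ p) ⟨
            b ^ (n ℕ.+ p)                     ≈⟨ trans (^-homo-* b n p) (*-comm _ _) ⟩
            b ^ p * b ^ n                     ≈⟨ *-congˡ (t-expansion n) ⟩
            b ^ p * sum (λ h → t h n * u h)   ≈⟨ *-sum-commute (b ^ p) (λ h → t h n) u ⟩
            sum (λ h → b ^ p * t h n * u h)   ∎) h

        -- Multiplied by bᵐ, the relation is one between vectors with scalars in `K`, so it holds in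
        -- each coordinate.
        t-relation : ∀ {n} (a : Vector Carrier n) → (∀ i → a i ∈ K) → sum (λ i → a i * b ^ toℕ i) ≈ 0# →
                     ∀ h m → sum (λ i → a i * t h (m ℕ.+ toℕ i)) ≈ 0#
        t-relation {n} a a∈K eq h m = u-independent (λ h → sum (λ i → a i * t h (m ℕ.+ toℕ i)))
          (λ h → sum-closed (λ i → *-closed (a∈K i) (t∈K h _)))
          (begin
            sum (λ h → sum (λ i → a i * t h (m ℕ.+ toℕ i)) * u h)
              ≈⟨ sum-cong-≋ (λ h → *-distribʳ-sum (u h) (λ i → a i * t h (m ℕ.+ toℕ i))) ⟩
            sum (λ h → sum (λ i → a i * t h (m ℕ.+ toℕ i) * u h))
              ≈⟨ ∑-comm (λ h i → a i * t h (m ℕ.+ toℕ i) * u h) ⟩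
            sum (λ i → sum (λ h → a i * t h (m ℕ.+ toℕ i) * u h))
              ≈⟨ sum-cong-≋ (λ i → trans (sym (*-sum-commute (a i) (λ h → t h (m ℕ.+ toℕ i)) u))
                   (*-congˡ (sym (t-expansion (m ℕ.+ toℕ i))))) ⟩
            sum (λ i → a i * b ^ (m ℕ.+ toℕ i))
              ≈⟨ sum-cong-≋ (λ i → trans (*-congˡ (^-homo-* b m (toℕ i)))
                   (solve 3 (λ a x y → a :* (x :* y) := x :* (a :* y)) refl (a i) (b ^ m) (b ^ toℕ i))) ⟩
            sum (λ i → b ^ m * (a i * b ^ toℕ i))
              ≈⟨ *-distribˡ-sum (b ^ m) (λ i → a i * b ^ toℕ i) ⟨
            b ^ m * sum (λ i → a i * b ^ toℕ i)
              ≈⟨ trans (*-congˡ eq) (zeroʳ (b ^ m)) ⟩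
            0# ∎) h

        -- Otherwise a nonzero `t h 0` would give b as the quotient of `t h 1` and `t h 0` in `K`.
        -- Hence all `t h 0` would vanish; but they are the coordinates of 1.
        t-not-geometric : ∃[ h ] ¬ (t h 1 ≈ b * t h 0)
        t-not-geometric with em {∃[ h ] ¬ (t h 1 ≈ b * t h 0)}
        ... | yes found = found
        ... | no none   = contradiction
          (trans (t-expansion 0) (sum-zero (λ h → trans (*-congʳ (t₀≈0 h)) (zeroˡ (u h))))) 1≉0
          where
          t₀≈0 : ∀ h → t h 0 ≈ 0#
          t₀≈0 h with em {t h 0 ≈ 0#} | em {t h 1 ≈ b * t h 0}
          ... | yes t₀≈0 | _       = t₀≈0
          ... | no _     | no t₁≉  = contradiction (h , t₁≉) none
          ... | no t₀≉0  | yes t₁≈ with inverse t₀≉0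
          ...   | y , t₀y≈1 = contradiction (resp-≈ (begin
                    t h 1 * y        ≈⟨ *-congʳ t₁≈ ⟩
                    b * t h 0 * y    ≈⟨ *-assoc b (t h 0) y ⟩
                    b * (t h 0 * y)  ≈⟨ trans (*-congˡ t₀y≈1) (*-identityʳ b) ⟩
                    b                ∎) (*-closed (t∈K h 1) (inv-closed (t∈K h 0) t₀y≈1))) b∉K

        coordinate-euler : ∀ {n} (a : Vector Carrier n) → (∀ i → a i ∈ K) →
          sum (λ i → a i * b ^ toℕ i) ≈ 0# → sum (λ i → (toℕ i · a i) * b ^ toℕ i) ≈ 0#
        coordinate-euler a a∈K eq with t-not-geometric
        ... | h , t₁≉bt₀ = sequence-euler b≉0 (t h) (t-periodic h) t₁≉bt₀ a (t-relation a a∈K eq h) eq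

      -- In other words, x ↦ b dx/db is a well-defined K-linear map on K(b).
      euler : ∀ {n} (a : Vector Carrier n) → (∀ i → a i ∈ K) →
              sum (λ i → a i * b ^ toℕ i) ≈ 0# → sum (λ i → (toℕ i · a i) * b ^ toℕ i) ≈ 0#
      euler with basis-extending 1≉0 (powers b p)
      ... | _ , _ , independent , _ , powers∈Span =
        Coordinates.coordinate-euler independent (λ n → span-trans powers∈Span (bⁿ∈Poly n))

      -- The operator b d/db kills the constant term, and after division by b a relation of length n
      -- with coefficients i aᵢ, 0 < i ≤ n, remains. The bound `suc n` ≤ p makes each such i
      -- invertible, so aᵢ = 0.
      powers-independent : ∀ n → n ℕ.≤ p → LinearlyIndependent K (powers b n)
      powers-independent zero    _     a a∈K eq ()
      powers-independent (suc n) sucn≤p a a∈K eq = λ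
        { zero    → trans (sym (trans (+-cong (*-identityʳ (a zero))
                      (sum-zero {n} (λ i → trans (*-congʳ (tail≈0 i)) (zeroˡ _)))) (+-identityʳ (a zero)))) eq
        ; (suc i) → tail≈0 i }
        where
        a′ : Vector Carrier n
        a′ i = suc (toℕ i) · a (suc i)

        a′-relation : sum (λ i → a′ i * b ^ toℕ i) ≈ 0#
        a′-relation = xy≈0∧x≉0⇒y≈0 (begin
          b * sum (λ i → a′ i * b ^ toℕ i)
            ≈⟨ *-distribˡ-sum b (λ i → a′ i * b ^ toℕ i) ⟩
          sum (λ i → b * (a′ i * b ^ toℕ i))
            ≈⟨ sum-cong-≋ (λ i → solve 3 (λ b a s → b :* (a :* s) := a :* (b :* s))
                 refl b (a′ i) (b ^ toℕ i)) ⟩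
          sum (λ i → a′ i * b ^ suc (toℕ i))
            ≈⟨ trans (+-congʳ (zeroˡ 1#)) (+-identityˡ _) ⟨
          sum (λ i → (toℕ i · a i) * b ^ toℕ i)
            ≈⟨ euler a a∈K eq ⟩
          0# ∎) b≉0

        tail≈0 : ∀ i → a (suc i) ≈ 0#
        tail≈0 i = n·x≈0⇒x≈0 z<s (ℕ.<-≤-trans (s≤s (Fin.toℕ<n i)) sucn≤p)
          (powers-independent n (ℕ.<⇒≤ sucn≤p) a′ (λ i → ·-closed (suc (toℕ i)) (a∈K (suc i))) a′-relation i)

-- Adjoining elements with given p-th powers: exchange, λ-families and p-independent tuples.

module Adjunction {ℓ} (F : HeytingField ℓ ℓ ℓ) (em : ExcludedMiddle ℓ) where
  open Over F
  open FieldTheory F em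
  open Powers F em
  open PIndependence F em
  open import Relation.Binary.Reasoning.Setoid setoid

  Only : Carrier → Subset
  Only x y = y ≈ x

  range-split : ∀ {n E} (b : Vector Carrier (suc n)) →
                E ⟨ Range b ⟩ ⊆ E ⟨ Range (tail b) ⟩ ⟨ Only (b zero) ⟩
  range-split b = ⟨⟩-least (⟨⟩-isSubfield _ _) (base⊆⟨⟩ ∘ base⊆⟨⟩)
    λ { (zero , x≈) → generators⊆⟨⟩ x≈ ; (suc i , x≈) → base⊆⟨⟩ (generators⊆⟨⟩ (i , x≈)) }

  range-tail : ∀ {n} (b : Vector Carrier (suc n)) → Range (tail b) ⊆ Range b
  range-tail b (i , x≈) = suc i , x≈

  sumExponents-cong : ∀ q n {f g : Vec (Fin q) n → Carrier} → (∀ I → f I ≈ g I) →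
                      sumExponents q n f ≈ sumExponents q n g
  sumExponents-cong q zero    f≈g = f≈g []
  sumExponents-cong q (suc n) f≈g = sum-cong-≋ (λ i → sumExponents-cong q n (λ I → f≈g (i ∷ I)))

  sumExponents-zero : ∀ q n → sumExponents q n (λ _ → 0#) ≈ 0#
  sumExponents-zero q zero    = refl
  sumExponents-zero q (suc n) = sum-zero {q} (λ _ → sumExponents-zero q n)

  sumExponents-+ : ∀ q n (f g : Vec (Fin q) n → Carrier) →
                   sumExponents q n (λ I → f I + g I) ≈ sumExponents q n f + sumExponents q n g
  sumExponents-+ q zero    f g = refl
  sumExponents-+ q (suc n) f g = trans
    (sum-cong-≋ (λ i → sumExponents-+ q n (λ I → f (i ∷ I)) (λ I → g (i ∷ I))))
    (∑-distrib-+ (λ i → sumExponents q n (λ I → f (i ∷ I))) (λ i → sumExponents q n (λ I → g (i ∷ I))))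

  sumExponents-* : ∀ q n x (f : Vec (Fin q) n → Carrier) →
                   x * sumExponents q n f ≈ sumExponents q n (λ I → x * f I)
  sumExponents-* q zero    x f = refl
  sumExponents-* q (suc n) x f = trans (*-distribˡ-sum x (λ i → sumExponents q n (λ I → f (i ∷ I))))
    (sum-cong-≋ (λ i → sumExponents-* q n x (λ I → f (i ∷ I))))

  sum-sumExponents : ∀ q n {m} (f : Fin m → Vec (Fin q) n → Carrier) →
    sum (λ i → sumExponents q n (f i)) ≈ sumExponents q n (λ I → sum (λ i → f i I))
  sum-sumExponents q n {zero}  f = sym (sumExponents-zero q n)
  sum-sumExponents q n {suc m} f = trans (+-congˡ (sum-sumExponents q n (f ∘ suc)))
    (sym (sumExponents-+ q n (f zero) (λ I → sum (λ i → f (suc i) I))))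

  sumExponents-closed : ∀ {K} → IsSubfield K → ∀ q n {f : Vec (Fin q) n → Carrier} →
                        (∀ I → f I ∈ K) → sumExponents q n f ∈ K
  sumExponents-closed K-isSubfield q zero    f∈K = f∈K []
  sumExponents-closed K-isSubfield q (suc n) f∈K =
    SubfieldProperties.sum-closed K-isSubfield (λ i → sumExponents-closed K-isSubfield q n (λ I → f∈K (i ∷ I)))

  monomial-closed : ∀ {K} → IsSubfield K → ∀ {q n} {b : Vector Carrier n} → (∀ i → b i ∈ K) →
                    (I : Vec (Fin q) n) → monomial b I ∈ K
  monomial-closed K-isSubfield b∈K I = product-closed (λ i → ^-closed (toℕ (Vec.lookup I i)) (b∈K i))
    where open SubfieldProperties K-isSubfield

  -- The expansion is read as a polynomial in `b zero` whose coefficients are expansions in the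
  -- tail; this is the form needed for induction on the tuple.
  sumExponents-∷ : ∀ q n (b : Vector Carrier (suc n)) (f : Vec (Fin q) (suc n) → Carrier) →
    sumExponents q (suc n) (λ I → monomial b I * f I ^ q) ≈
    sum {q} (λ i → sumExponents q n (λ I → monomial (tail b) I * f (i ∷ I) ^ q) * b zero ^ toℕ i)
  sumExponents-∷ q n b f = sum-cong-≋ {q} (λ i → begin
    sumExponents q n (λ I → b zero ^ toℕ i * monomial (tail b) I * f (i ∷ I) ^ q)
      ≈⟨ sumExponents-cong q n (λ I → *-assoc (b zero ^ toℕ i) (monomial (tail b) I) (f (i ∷ I) ^ q)) ⟩
    sumExponents q n (λ I → b zero ^ toℕ i * (monomial (tail b) I * f (i ∷ I) ^ q))
      ≈⟨ sumExponents-* q n (b zero ^ toℕ i) _ ⟨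
    b zero ^ toℕ i * sumExponents q n (λ I → monomial (tail b) I * f (i ∷ I) ^ q)
      ≈⟨ *-comm _ _ ⟩
    sumExponents q n (λ I → monomial (tail b) I * f (i ∷ I) ^ q) * b zero ^ toℕ i ∎)

  module Tuples {p} (p≢0 : p ≢ 0) (char : IsCharacteristic p) where
    open Independence p≢0 char public

    ^p⊆ : ∀ {k} → IsSubfield k → k ^⦅ p ⦆ ⊆ k
    ^p⊆ k-isSubfield (y , y∈k , x≈) = resp-≈ (sym x≈) (^-closed p y∈k)
      where open SubfieldProperties k-isSubfield

    module _ {k K : Subset} (k-isSubfield : IsSubfield k) (K-isSubfield : IsSubfield K)
             (kᵖ⊆K : k ^⦅ p ⦆ ⊆ K) (K⊆k : K ⊆ k) {x} (x∈k : x ∈ k) where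
      private module k = SubfieldProperties k-isSubfield
      open SubfieldProperties K-isSubfield
      open Polynomial K-isSubfield x

      private
        constant : ∀ {y} → y ∈ K → y ∈ Poly p
        constant = constant∈Poly 0<p

        xᵖ∈Poly : (x ^ p) ∈ Poly p
        xᵖ∈Poly = constant (kᵖ⊆K (x , x∈k , refl))

        open Reduced xᵖ∈Poly

        Poly⊆k : Poly p ⊆ k
        Poly⊆k (combination a a∈K y≈) = k.resp-≈ (sym y≈)
          (k.sum-closed (λ i → k.*-closed (K⊆k (a∈K i)) (k.^-closed (toℕ i) x∈k)))

        poly-power : ∀ {y} n → y ∈ Poly p → (y ^ n) ∈ Poly p
        poly-power zero    _  = constant 1-closed
        poly-power (suc n) y∈ = reduced-* y∈ (poly-power n y∈)

        -- 1/y = yᵖ⁻¹ (1/y)ᵖ with (1/y)ᵖ ∈ kᵖ ⊆ K.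
        inverse-as-power : ∀ {y z} → y * z ≈ 1# → ∀ q → y ^ q * z ^ suc q ≈ z
        inverse-as-power {y} {z} yz≈1 q = begin
          y ^ q * (z * z ^ q)  ≈⟨ solve 3 (λ s z t → s :* (z :* t) := z :* (s :* t)) refl (y ^ q) z (z ^ q) ⟩
          z * (y ^ q * z ^ q)  ≈⟨ *-congˡ (^-distrib-* y z q) ⟨
          z * (y * z) ^ q      ≈⟨ trans (*-congˡ (trans (^-congˡ q yz≈1) (1^n≈1 q))) (*-identityʳ z) ⟩
          z                    ∎

        poly-inv : ∀ {y z} → y ∈ Poly p → y * z ≈ 1# → z ∈ Poly p
        poly-inv {y} {z} y∈ yz≈1 = span-resp
          (trans (*-congˡ (reflexive (≡.cong (z ^_) (≡.sym (ℕ.suc-pred p {{ℕ.≢-nonZero p≢0}})))))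
                 (inverse-as-power yz≈1 (ℕ.pred p)))
          (reduced-* (poly-power (ℕ.pred p) y∈) (constant (kᵖ⊆K (z , k.inv-closed (Poly⊆k y∈) yz≈1 , refl))))

      -- As xᵖ lies in K, the ring K[x] is spanned by the powers below p, and it is already a field.
      -- The ambient field `k` may be smaller than F, so that λ-coordinates can later be found in a
      -- given subfield.
      adjoin⊆Poly : K ⟨ Only x ⟩ ⊆ Poly p
      adjoin⊆Poly = ⟨⟩-least isSubfield constant
        (λ y≈x → span-resp (trans (*-identityʳ x) (sym y≈x)) (reduced-x* (constant 1-closed)))
        where
        isSubfield : IsSubfield (Poly p)
        isSubfield = record
          { resp-≈ = span-resp ; 0-closed = span-zero ; 1-closed = constant 1-closed ; +-closed = span-+
          ; neg-closed = span-neg ; *-closed = reduced-* ; inv-closed = poly-inv }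

    -- If x were not in K(y), its powers below p would be independent over K(y). But y is a
    -- polynomial in x over K, and moving y into the constant coefficient gives a relation over
    -- K(y); so y would equal the constant coefficient, which is in K.
    exchange : ∀ {K} → IsSubfield K → Whole ^⦅ p ⦆ ⊆ K → ∀ {x y} →
               y ∈ K ⟨ Only x ⟩ → ¬ (y ∈ K) → x ∈ K ⟨ Only y ⟩
    exchange {K} K-isSubfield Fᵖ⊆K {x} {y} y∈K⟨x⟩ y∉K with em {x ∈ K ⟨ Only y ⟩}
    ... | yes x∈ = x∈
    ... | no x∉  = contradiction (expand p≢0 ℕ.≤-refl y∈Poly) y∉K
      where
      open Polynomial K-isSubfield x
      open SubfieldProperties (⟨⟩-isSubfield K (Only y)) using (+-closed; neg-closed; ∷-closed)
      K-resp = IsSubfield.resp-≈ K-isSubfield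

      y∈Poly : y ∈ Poly p
      y∈Poly = adjoin⊆Poly whole-isSubfield K-isSubfield Fᵖ⊆K _ _ y∈K⟨x⟩

      expand : ∀ {n} → n ≢ 0 → n ℕ.≤ p → y ∈ Poly n → y ∈ K
      expand {zero}  n≢0 _ _ = contradiction ≡.refl n≢0
      expand {suc n} _ n≤p (SubfieldProperties.combination a a∈K y≈) = K-resp (x-y≈0⇒x≈y (a zero) y (Simple.powers-independent
        (⟨⟩-isSubfield K (Only y)) (base⊆⟨⟩ (Fᵖ⊆K (x , _ , refl))) x∉ (suc n) n≤p
        ((a zero + - y) Vector.∷ tail a)
        (∷-closed (+-closed (base⊆⟨⟩ (a∈K zero)) (neg-closed (generators⊆⟨⟩ refl))) (λ i → base⊆⟨⟩ (a∈K (suc i))))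
        (begin
          (a zero + - y) * 1# + s
            ≈⟨ solve 3 (λ a y s → (a :+ (:- y)) :* con (1 , 0) :+ s := (a :* con (1 , 0) :+ s) :+ (:- y))
                 refl (a zero) y s ⟩
          (a zero * 1# + s) + - y
            ≈⟨ +-congʳ y≈ ⟨
          y + - y
            ≈⟨ -‿inverseʳ y ⟩
          0# ∎) zero)) (a∈K zero)
        where
        s = sum (λ i → a (suc i) * x ^ suc (toℕ i))

    -- Expand x in powers of `b zero` over the field generated by kᵖ and the tail, then expand the
    -- coefficients recursively. For the empty tuple that field is kᵖ itself.
    lambda-family : ∀ {k} → IsSubfield k → ∀ {n} (b : Vector Carrier n) → (∀ i → b i ∈ k) →
      ∀ {x} → x ∈ (k ^⦅ p ⦆) ⟨ Range b ⟩ →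
      Σ (Vec (Fin p) n → Carrier) λ f → (∀ I → f I ∈ k) × IsLambdaFamily p b x f
    lambda-family {k} k-isSubfield {zero} b b∈k {x} x∈ =
      root (⟨⟩-least {A = Range b} (^p-isSubfield k-isSubfield) id (λ ()) x∈)
      where
      root : x ∈ k ^⦅ p ⦆ → Σ (Vec (Fin p) 0 → Carrier) λ f → (∀ I → f I ∈ k) × IsLambdaFamily p b x f
      root (y , y∈k , x≈) = (λ _ → y) , (λ _ → y∈k) , trans x≈ (sym (*-identityˡ (y ^ p)))
    lambda-family {k} k-isSubfield {suc n} b b∈k {x} x∈ =
      expand (adjoin⊆Poly k-isSubfield (⟨⟩-isSubfield (k ^⦅ p ⦆) (Range (tail b))) base⊆⟨⟩
               (⟨⟩-least k-isSubfield (^p⊆ k-isSubfield) λ (i , y≈) → IsSubfield.resp-≈ k-isSubfield (sym y≈) (b∈k (suc i)))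
               (b∈k zero) (range-split b x∈))
      where
      open SubfieldProperties (⟨⟩-isSubfield (k ^⦅ p ⦆) (Range (tail b))) using (Span; combination)

      expand : x ∈ Span (powers (b zero) p) →
               Σ (Vec (Fin p) (suc n) → Carrier) λ f → (∀ I → f I ∈ k) × IsLambdaFamily p b x f
      expand (combination a a∈K x≈) = f , f∈k , (begin
        x
          ≈⟨ x≈ ⟩
        sum (λ i → a i * b zero ^ toℕ i)
          ≈⟨ sum-cong-≋ {p} (λ i → *-congʳ (proj₂ (proj₂ (families i)))) ⟩
        sum {p} (λ i → sumExponents p n (λ I → monomial (tail b) I * f (i ∷ I) ^ p) * b zero ^ toℕ i)
          ≈⟨ sumExponents-∷ p n b f ⟨
        sumExponents p (suc n) (λ I → monomial b I * f I ^ p) ∎)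
        where
        families : ∀ i → Σ (Vec (Fin p) n → Carrier) λ f → (∀ I → f I ∈ k) × IsLambdaFamily p (tail b) (a i) f
        families i = lambda-family k-isSubfield (tail b) (b∈k ∘ suc) (a∈K i)

        f : Vec (Fin p) (suc n) → Carrier
        f (i ∷ I) = proj₁ (families i) I

        f∈k : ∀ I → f I ∈ k
        f∈k (i ∷ I) = proj₁ (proj₂ (families i)) I

    -- p-independence of a tuple, tested along the tower of the fields generated by its tails.
    TowerIndependent : ∀ {n} → Vector Carrier n → Set ℓ
    TowerIndependent {zero}  b = ⊤
    TowerIndependent {suc n} b = ¬ (b zero ∈ (Whole ^⦅ p ⦆) ⟨ Range (tail b) ⟩) × TowerIndependent (tail b)

    -- As a polynomial in `b zero` of degree below p, the relation has coefficients in the field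
    -- generated by Fᵖ and the tail, so each coefficient vanishes and is again a relation of the
    -- same kind.
    monomials-independent : ∀ {n} (b : Vector Carrier n) → TowerIndependent b →
      (f : Vec (Fin p) n → Carrier) → sumExponents p n (λ I → monomial b I * f I ^ p) ≈ 0# → ∀ I → f I ≈ 0#
    monomials-independent {zero}  b _ f eq [] = x^n≈0⇒x≈0 p (trans (sym (*-identityˡ _)) eq)
    monomials-independent {suc n} b (b₀∉ , ind) f eq (i ∷ I) = monomials-independent (tail b) ind (λ I → f (i ∷ I))
      (Simple.powers-independent K-isSubfield (base⊆⟨⟩ (b zero , _ , refl)) b₀∉ p ℕ.≤-refl
        (λ i → sumExponents p n (λ I → monomial (tail b) I * f (i ∷ I) ^ p))
        (λ i → sumExponents-closed K-isSubfield p n (λ I → IsSubfield.*-closed K-isSubfield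
          (monomial-closed K-isSubfield (λ j → generators⊆⟨⟩ (j , refl)) I) (base⊆⟨⟩ (f (i ∷ I) , _ , refl))))
        (trans (sym (sumExponents-∷ p n b f)) eq) i) I
      where
      K-isSubfield = ⟨⟩-isSubfield (Whole ^⦅ p ⦆) (Range (tail b))

    lambda-family-unique : ∀ {n} {b : Vector Carrier n} → TowerIndependent b → ∀ {x f g} →
      IsLambdaFamily p b x f → IsLambdaFamily p b x g → ∀ I → f I ≈ g I
    lambda-family-unique {n} {b} ind {x} {f} {g} x≈f x≈g I = x-y≈0⇒x≈y (f I) (g I)
      (monomials-independent b ind (λ I → f I + - g I) (begin
        sumExponents p n (λ I → monomial b I * (f I + - g I) ^ p)
          ≈⟨ sumExponents-cong p n (λ I → trans
               (*-congˡ (trans (frobenius-+ (f I) (- g I)) (+-congˡ (frobenius-neg (g I)))))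
               (solve 3 (λ m s t → m :* (s :+ (:- t)) := m :* s :+ (:- con (1 , 0)) :* (m :* t)) refl (monomial b I) (f I ^ p) (g I ^ p))) ⟩
        sumExponents p n (λ I → monomial b I * f I ^ p + - 1# * (monomial b I * g I ^ p))
          ≈⟨ sumExponents-+ p n (λ I → monomial b I * f I ^ p) (λ I → - 1# * (monomial b I * g I ^ p)) ⟩
        sumExponents p n (λ I → monomial b I * f I ^ p) + sumExponents p n (λ I → - 1# * (monomial b I * g I ^ p))
          ≈⟨ +-cong (sym x≈f) (trans (sym (sumExponents-* p n (- 1#) (λ I → monomial b I * g I ^ p))) (*-congˡ (sym x≈g))) ⟩
        x + - 1# * x
          ≈⟨ solve 1 (λ x → x :+ (:- con (1 , 0)) :* x := con (0 , 0)) refl x ⟩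
        0# ∎) I)

    -- Distinctness of the entries places the tail inside the set of entries other than `b zero`.
    pIndependent⇒tower : ∀ {n} {b : Vector Carrier n} → IsPIndependentTuple p b → TowerIndependent b
    pIndependent⇒tower {zero} _ = _
    pIndependent⇒tower {suc n} {b} (distinct , _ , independent) =
      (λ b₀∈ → independent (b zero) (zero , refl) (⟨⟩-mono id avoid b₀∈)) ,
      pIndependent⇒tower ((λ i j eq → Fin.suc-injective (distinct (suc i) (suc j) eq)) , _ ,
        λ x x∈ x∈⟨⟩ → independent x (range-tail b x∈) (⟨⟩-mono id (λ (y∈ , y≉x) → range-tail b y∈ , y≉x) x∈⟨⟩))
      where
      avoid : Range (tail b) ⊆ Range b ∖ b zero
      avoid (i , y≈) = (suc i , y≈) , λ y≈b₀ → Fin.0≢1+n (distinct zero (suc i) (trans (sym y≈b₀) y≈))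

    -- An entry of the tail that depends on all the others, but not on the rest of the tail, could
    -- be exchanged with the head, making the head depend on the tail.
    tower⇒pIndependent : ∀ {n} {b : Vector Carrier n} → TowerIndependent b → IsPIndependentTuple p b
    tower⇒pIndependent {zero} _ = (λ ()) , _ , λ { x (() , _) }
    tower⇒pIndependent {suc n} {b} (b₀∉ , ind) with tower⇒pIndependent ind
    ... | distinct , _ , independent = distinct′ , _ , independent′
      where
      distinct′ : ∀ i j → b i ≈ b j → i ≡ j
      distinct′ zero    zero    _  = ≡.refl
      distinct′ zero    (suc j) eq = contradiction (generators⊆⟨⟩ (j , eq)) b₀∉
      distinct′ (suc i) zero    eq = contradiction (generators⊆⟨⟩ (i , sym eq)) b₀∉
      distinct′ (suc i) (suc j) eq = ≡.cong suc (distinct i j eq)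

      independent′ : ∀ x → x ∈ Range b → ¬ (x ∈ (Whole ^⦅ p ⦆) ⟨ Range b ∖ x ⟩)
      independent′ x (zero , x≈b₀) x∈ = b₀∉ (resp x≈b₀ (⟨⟩-mono id
        (λ { ((zero , y≈) , y≉x) → contradiction (trans y≈ (sym x≈b₀)) y≉x ; ((suc i , y≈) , _) → i , y≈ }) x∈))
      independent′ x (suc i , x≈bᵢ) x∈ = b₀∉ (⟨⟩-least (⟨⟩-isSubfield _ _)
        (⟨⟩-mono id proj₁) (λ y≈x → generators⊆⟨⟩ (i , trans y≈x x≈bᵢ))
        (exchange (⟨⟩-isSubfield (Whole ^⦅ p ⦆) (Range (tail b) ∖ x)) base⊆⟨⟩ x∈′ (independent x (i , x≈bᵢ))))
        where
        x∈′ : x ∈ (Whole ^⦅ p ⦆) ⟨ Range (tail b) ∖ x ⟩ ⟨ Only (b zero) ⟩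
        x∈′ = ⟨⟩-least (⟨⟩-isSubfield _ _) (base⊆⟨⟩ ∘ base⊆⟨⟩)
          (λ { ((zero , y≈) , _) → generators⊆⟨⟩ y≈ ; ((suc j , y≈) , y≉x) → base⊆⟨⟩ (generators⊆⟨⟩ ((j , y≈) , y≉x)) }) x∈

    maximal-independent : ∀ {A : Subset} {m} (t : Vector Carrier m) → (∀ j → t j ∈ A) →
      ∃[ n ] Σ (Vector Carrier n) λ b → (∀ i → b i ∈ A) × TowerIndependent b ×
        (∀ j → t j ∈ (Whole ^⦅ p ⦆) ⟨ Range b ⟩)
    maximal-independent {m = zero}  t _ = 0 , (λ ()) , (λ ()) , _ , λ ()
    maximal-independent {A} {m = suc m} t t∈A with maximal-independent {A} (tail t) (t∈A ∘ suc)
    ... | n , b , b∈A , ind , t∈ with em {t zero ∈ (Whole ^⦅ p ⦆) ⟨ Range b ⟩}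
    ...   | yes t₀∈ = n , b , b∈A , ind , λ { zero → t₀∈ ; (suc j) → t∈ j }
    ...   | no t₀∉  = suc n , t zero Vector.∷ b , (λ { zero → t∈A zero ; (suc i) → b∈A i }) , (t₀∉ , ind) ,
      λ { zero → generators⊆⟨⟩ (zero , refl) ; (suc j) → ⟨⟩-mono id (λ (i , y≈) → suc i , y≈) (t∈ j) }

-- Separability through Frobenius, and its relation to λ-families.

module Separability {ℓ} (F : HeytingField ℓ ℓ ℓ) (em : ExcludedMiddle ℓ) where
  open Over F
  open FieldTheory F em
  open Powers F em
  open PIndependence F em
  open Adjunction F em
  open import Relation.Binary.Reasoning.Setoid setoid

  module Embedding (O : Overfield F) where
    open Overfield O using (ι; ι-isRingHomomorphism) public
    open IsRingHomomorphism ι-isRingHomomorphism public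
      using () renaming (⟦⟧-cong to ι-cong; +-homo to ι-+; *-homo to ι-*; 0#-homo to ι-0#; 1#-homo to ι-1#)
    module Ω where
      open Over (Overfield.Ω O) public
      open FieldTheory (Overfield.Ω O) em public
      open Powers (Overfield.Ω O) em public

    ι-^ : ∀ x n → ι (x ^ n) Ω.≈ ι x Ω.^ n
    ι-^ x zero    = ι-1#
    ι-^ x (suc n) = Ω.trans (ι-* x (x ^ n)) (Ω.*-congˡ (ι-^ x n))

    ι-sum : ∀ {n} (f : Vector Carrier n) → ι (sum f) Ω.≈ Ω.sum (λ i → ι (f i))
    ι-sum {zero}  f = ι-0#
    ι-sum {suc n} f = Ω.trans (ι-+ (f zero) (sum (tail f))) (Ω.+-congˡ (ι-sum (tail f)))

    ι-combination : ∀ {n} (a u : Vector Carrier n) → ι (sum (λ i → a i * u i)) Ω.≈ Ω.sum (λ i → ι (a i) Ω.* ι (u i))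
    ι-combination a u = Ω.trans (ι-sum (λ i → a i * u i)) (Ω.sum-cong-≋ (λ i → ι-* (a i) (u i)))

    ι-· : ∀ n → ι (n · 1#) Ω.≈ n Ω.· Ω.1#
    ι-· zero    = ι-0#
    ι-· (suc n) = Ω.trans (ι-+ 1# (n · 1#)) (Ω.+-cong ι-1# (ι-· n))

    ι≈0⇒≈0 : ∀ {x} → ι x Ω.≈ Ω.0# → x ≈ 0#
    ι≈0⇒≈0 {x} ιx≈0 with em {x ≈ 0#}
    ... | yes x≈0 = x≈0
    ... | no x≉0  = contradiction (Ω.trans (Ω.sym ι-1#) (Ω.trans (ι-cong (sym (proj₂ (inverse x≉0))))
                      (Ω.trans (ι-* x _) (Ω.trans (Ω.*-congʳ ιx≈0) (Ω.zeroˡ _))))) Ω.1≉0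

    characteristic : ∀ {p} → IsCharacteristic p → Ω.IsCharacteristic p
    characteristic char m = mk⇔
      (λ m1≈0 → Equivalence.to (char m) (ι≈0⇒≈0 (Ω.trans (ι-· m) m1≈0)))
      (λ p∣m → Ω.trans (Ω.sym (ι-· m)) (Ω.trans (ι-cong (Equivalence.from (char m) p∣m)) ι-0#))

  module Separable {p} (p≢0 : p ≢ 0) (char : IsCharacteristic p) where
    open Tuples p≢0 char public

    -- Linear disjointness of F and E^(1/p) over E, transported to F by Frobenius.
    FrobeniusPreservesIndependence : Subset → Set ℓ
    FrobeniusPreservesIndependence E = ∀ {n} (w : Vector Carrier n) →
      LinearlyIndependent E w → LinearlyIndependent E (λ i → w i ^ p)

    -- Replace the coefficients aᵢ by their p-th roots dᵢ in the overfield: the relation becomes (Σ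
    -- dᵢ wᵢ)ᵖ = 0, and linear disjointness forces dᵢ = 0.
    separable⇒frobenius : ∀ {E} → IsSeparable F p E → FrobeniusPreservesIndependence E
    separable⇒frobenius {E} (O , hasRoots , disjoint) {n} w w-independent a a∈E eq i =
      ι≈0⇒≈0 (Ω.trans (Ω.sym (dᵖ≈ i)) (Ω.trans (Ω.^-congˡ p (d≈0 i)) Ωp.0^p≈0))
      where
      open Embedding O
      module Ωp = Ω.Characteristic p≢0 (characteristic char)

      d : Vector Ω.Carrier n
      d i = proj₁ (hasRoots (a i) (a∈E i))

      dᵖ≈ : ∀ i → d i Ω.^ p Ω.≈ ι (a i)
      dᵖ≈ i = proj₂ (hasRoots (a i) (a∈E i))

      ιw-independent : Ω.LinearlyIndependent (Overfield.image O E) (λ i → ι (w i))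
      ιw-independent b b∈ b-eq i = Ω.trans (proj₂ (proj₂ (b∈ i))) (Ω.trans (ι-cong (x≈0 i)) ι-0#)
        where
        x : Vector Carrier n
        x i = proj₁ (b∈ i)
        x≈0 : ∀ i → x i ≈ 0#
        x≈0 = w-independent x (λ i → proj₁ (proj₂ (b∈ i))) (ι≈0⇒≈0 (Ω.trans (ι-combination x w)
          (Ω.trans (Ω.sum-cong-≋ (λ i → Ω.*-congʳ (Ω.sym (proj₂ (proj₂ (b∈ i)))))) b-eq)))

      d≈0 : ∀ i → d i Ω.≈ Ω.0#
      d≈0 = disjoint n (λ i → ι (w i)) (λ i → w i , _ , Ω.refl) ιw-independent d
        (λ i → a i , a∈E i , dᵖ≈ i)
        (Ω.x^n≈0⇒x≈0 p (Ω.trans (Ωp.frobenius-sum (λ i → d i Ω.* ι (w i)))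
          (Ω.trans (Ω.sum-cong-≋ (λ i → Ω.trans (Ω.^-distrib-* (d i) (ι (w i)) p)
                     (Ω.*-cong (dᵖ≈ i) (Ω.sym (ι-^ (w i) p)))))
          (Ω.trans (Ω.sym (ι-combination a (λ i → w i ^ p))) (Ω.trans (ι-cong eq) ι-0#)))))

    -- Under this embedding F becomes Fᵖ and E becomes Eᵖ, while the p-th roots of elements of E
    -- form E itself, by injectivity of Frobenius.
    frobeniusOverfield : Overfield F
    frobeniusOverfield = record
      { Ω = F
      ; ι = _^ p
      ; ι-isRingHomomorphism = record
        { isSemiringHomomorphism = record
          { isNearSemiringHomomorphism = record
            { +-isMonoidHomomorphism = record
              { isMagmaHomomorphism = record
                { isRelHomomorphism = record { cong = ^-congˡ p }
                ; homo = frobenius-+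
                }
              ; ε-homo = 0^p≈0
              }
            ; *-homo = λ x y → ^-distrib-* x y p
            }
          ; 1#-homo = 1^n≈1 p
          }
        ; -‿homo = frobenius-neg
        }
      }

    frobenius⇒separable : ∀ {E} → IsSubfield E → FrobeniusPreservesIndependence E → IsSeparable F p E
    frobenius⇒separable {E} E-isSubfield preserves = frobeniusOverfield , (λ x _ → x , refl) , disjoint
      where
      open IsSubfield E-isSubfield
      open Overfield frobeniusOverfield using (image; roots)
      disjoint : LinearlyDisjoint (image E) (image Whole) (roots p E)
      disjoint n v v∈ v-independent a a∈ eq = preserves w w-independent a
        (λ i → resp-≈ (sym (frobenius-injective (proj₂ (proj₂ (a∈ i))))) (proj₁ (proj₂ (a∈ i))))
        (trans (sum-cong-≋ (λ i → *-congˡ (sym (v≈ i)))) eq)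
        where
        w : Vector Carrier n
        w i = proj₁ (v∈ i)
        v≈ : ∀ i → v i ≈ w i ^ p
        v≈ i = proj₂ (proj₂ (v∈ i))
        -- The p-th power of a relation between the `w i` over E is a relation between the `v i`
        -- over Eᵖ.
        w-independent : LinearlyIndependent E w
        w-independent c c∈E c-eq i = x^n≈0⇒x≈0 p (v-independent (λ i → c i ^ p) (λ i → c i , c∈E i , refl) (begin
          sum (λ i → c i ^ p * v i)
            ≈⟨ sum-cong-≋ (λ i → trans (*-congˡ (v≈ i)) (sym (^-distrib-* (c i) (w i) p))) ⟩
          sum (λ i → (c i * w i) ^ p)   ≈⟨ frobenius-sum (λ i → c i * w i) ⟨
          sum (λ i → c i * w i) ^ p     ≈⟨ trans (^-congˡ p c-eq) 0^p≈0 ⟩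
          0#                            ∎) i)

    -- Expand all f I in a basis over E that contains 1, and compare coefficients.
    lambda-family-closed : ∀ {E} → IsSubfield E → FrobeniusPreservesIndependence E →
      ∀ {n} {b : Vector Carrier n} → (∀ i → b i ∈ E) → TowerIndependent b →
      ∀ {x} → x ∈ E → ∀ {f} → IsLambdaFamily p b x f → ∀ I → f I ∈ E
    lambda-family-closed {E} E-isSubfield preserves {n} {b} b∈E ind {x} x∈E {f} x≈ =
      -- The exponent tuples are enumerated by `Fin (p ^ n)`, so that the family becomes a finite
      -- vector.
      coefficients-in-basis (basis-extending 1≉0 {p ℕ.^ n} (f ∘ Vec.tabulate ∘ finToFun))
      where
      open SubfieldProperties E-isSubfield

      module _ {r} (u : Vector Carrier r) (independent : LinearlyIndependent E u)
               i₀ (uᵢ₀≈1 : u i₀ ≈ 1#) (f∈Span : ∀ I → f I ∈ Span u) where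
        c : Vec (Fin p) n → Fin r → Carrier
        c I = Span.coefficient (f∈Span I)

        c∈E : ∀ I j → c I j ∈ E
        c∈E I = Span.coefficient∈K (f∈Span I)

        d : Fin r → Carrier
        d j = sumExponents p n (λ I → monomial b I * c I j ^ p)

        x-expansion : x ≈ sum (λ j → d j * u j ^ p)
        x-expansion = begin
          x
            ≈⟨ x≈ ⟩
          sumExponents p n (λ I → monomial b I * f I ^ p)
            ≈⟨ sumExponents-cong p n (λ I → trans
                 (*-congˡ (trans (^-congˡ p (Span.expansion (f∈Span I))) (frobenius-sum (λ j → c I j * u j))))
                 (trans (*-distribˡ-sum (monomial b I) (λ j → (c I j * u j) ^ p))
                   (sum-cong-≋ (λ j → trans (*-congˡ (^-distrib-* (c I j) (u j) p))
                     (solve 3 (λ m s t → m :* (s :* t) := t :* (m :* s)) refl (monomial b I) (c I j ^ p) (u j ^ p)))))) ⟩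
          sumExponents p n (λ I → sum (λ j → u j ^ p * (monomial b I * c I j ^ p)))
            ≈⟨ sum-sumExponents p n (λ j I → u j ^ p * (monomial b I * c I j ^ p)) ⟨
          sum (λ j → sumExponents p n (λ I → u j ^ p * (monomial b I * c I j ^ p)))
            ≈⟨ sum-cong-≋ (λ j → trans (sym (sumExponents-* p n (u j ^ p) (λ I → monomial b I * c I j ^ p))) (*-comm (u j ^ p) (d j))) ⟩
          sum (λ j → d j * u j ^ p) ∎

        -- Since x = x · 1ᵖ with 1 in the basis, x has two expansions in the p-th powers of the
        -- basis vectors, which are still independent over E.
        d≈single : ∀ j → d j ≈ single i₀ x j
        d≈single = independent-unique (preserves u independent)
          (λ j → sumExponents-closed E-isSubfield p n (λ I → *-closed (monomial-closed E-isSubfield b∈E I) (^-closed p (c∈E I j))))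
          (single-closed i₀ x∈E)
          (begin
            sum (λ j → d j * u j ^ p)             ≈⟨ x-expansion ⟨
            x                                     ≈⟨ *-identityʳ x ⟨
            x * 1#                                ≈⟨ *-congˡ (trans (^-congˡ p uᵢ₀≈1) (1^n≈1 p)) ⟨
            x * u i₀ ^ p                          ≈⟨ sum-single i₀ x (λ j → u j ^ p) ⟨
            sum (λ j → single i₀ x j * u j ^ p)   ∎)

        -- Away from `i₀`, the vanishing of `d j` is a relation between monomials with coefficients
        -- `c I j ^ p`.
        c≈single : ∀ I j → c I j ≈ single i₀ (c I i₀) j
        c≈single I j with i₀ Fin.≟ j
        ... | yes ≡.refl = sym (single-≡ i₀ (c I i₀))
        ... | no i₀≢j    = trans (monomials-independent b ind (λ I → c I j) (trans (d≈single j) (single-≢ x i₀≢j)) I)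
                             (sym (single-≢ (c I i₀) i₀≢j))

        f∈E : ∀ I → f I ∈ E
        f∈E I = resp-≈ (sym (begin
          f I                                        ≈⟨ Span.expansion (f∈Span I) ⟩
          sum (λ j → c I j * u j)                    ≈⟨ sum-cong-≋ (λ j → *-congʳ (c≈single I j)) ⟩
          sum (λ j → single i₀ (c I i₀) j * u j)     ≈⟨ sum-single i₀ (c I i₀) u ⟩
          c I i₀ * u i₀                              ≈⟨ trans (*-congˡ uᵢ₀≈1) (*-identityʳ (c I i₀)) ⟩
          c I i₀                                     ∎)) (c∈E I i₀)

      coefficients-in-basis : (∃[ r ] Σ (Vector Carrier r) λ u →
        LinearlyIndependent E u × (∃[ i ] u i ≈ 1#) × (∀ j → f (Vec.tabulate (finToFun j)) ∈ Span u)) → ∀ I → f I ∈ E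
      coefficients-in-basis (_ , u , independent , (i₀ , uᵢ₀≈1) , f∈Span) =
        f∈E u independent i₀ uᵢ₀≈1 λ I → ≡.subst (λ J → f J ∈ Span u)
          (≡.trans (Vec.tabulate-cong (Fin.finToFun-funToFin (Vec.lookup I))) (Vec.tabulate∘lookup I))
          (f∈Span (funToFin (Vec.lookup I)))

    -- With aᵢ = Σ bᴵ zᵢᴵᵖ and zᵢᴵ in E, the relation reads Σ bᴵ (Σᵢ zᵢᴵ wᵢ)ᵖ = 0. Independence of
    -- monomials gives Σᵢ zᵢᴵ wᵢ = 0 for every I, and independence of w over E gives zᵢᴵ = 0.
    locally-generated⇒frobenius : ∀ {E} → IsSubfield E →
      (∀ {m} (a : Vector Carrier m) → (∀ i → a i ∈ E) →
        ∃[ n ] Σ (Vector Carrier n) λ b → (∀ j → b j ∈ E) × TowerIndependent b ×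
          (∀ i → a i ∈ (E ^⦅ p ⦆) ⟨ Range b ⟩)) →
      FrobeniusPreservesIndependence E
    locally-generated⇒frobenius {E} E-isSubfield locally {m} w w-independent a a∈E eq = conclude (locally a a∈E)
      where
      conclude : (∃[ n ] Σ (Vector Carrier n) λ b → (∀ j → b j ∈ E) × TowerIndependent b ×
                   (∀ i → a i ∈ (E ^⦅ p ⦆) ⟨ Range b ⟩)) → ∀ i → a i ≈ 0#
      conclude (n , b , b∈E , ind , a∈) i = trans (a≈ i) (trans
        (sumExponents-cong p n (λ I → trans (*-congˡ (trans (^-congˡ p (z≈0 I i)) 0^p≈0)) (zeroʳ (monomial b I))))
        (sumExponents-zero p n))
        where
        family : ∀ i → Σ (Vec (Fin p) n → Carrier) λ f → (∀ I → f I ∈ E) × IsLambdaFamily p b (a i) f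
        family i = lambda-family E-isSubfield b b∈E (a∈ i)

        z : Fin m → Vec (Fin p) n → Carrier
        z i = proj₁ (family i)

        a≈ : ∀ i → a i ≈ sumExponents p n (λ I → monomial b I * z i I ^ p)
        a≈ i = proj₂ (proj₂ (family i))

        s≈0 : ∀ I → sum (λ i → z i I * w i) ≈ 0#
        s≈0 = monomials-independent b ind (λ I → sum (λ i → z i I * w i)) (begin
          sumExponents p n (λ I → monomial b I * sum (λ i → z i I * w i) ^ p)
            ≈⟨ sumExponents-cong p n (λ I → trans (*-congˡ (frobenius-sum (λ i → z i I * w i)))
                 (trans (*-distribˡ-sum (monomial b I) (λ i → (z i I * w i) ^ p))
                   (sum-cong-≋ (λ i → trans (*-congˡ (^-distrib-* (z i I) (w i) p))
                     (solve 3 (λ m s t → m :* (s :* t) := t :* (m :* s)) refl (monomial b I) (z i I ^ p) (w i ^ p)))))) ⟩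
          sumExponents p n (λ I → sum (λ i → w i ^ p * (monomial b I * z i I ^ p)))
            ≈⟨ sum-sumExponents p n (λ i I → w i ^ p * (monomial b I * z i I ^ p)) ⟨
          sum (λ i → sumExponents p n (λ I → w i ^ p * (monomial b I * z i I ^ p)))
            ≈⟨ sum-cong-≋ (λ i → trans (sym (sumExponents-* p n (w i ^ p) (λ I → monomial b I * z i I ^ p)))
                 (trans (*-congˡ (sym (a≈ i))) (*-comm (w i ^ p) (a i)))) ⟩
          sum (λ i → a i * w i ^ p)
            ≈⟨ eq ⟩
          0# ∎)

        z≈0 : ∀ I i → z i I ≈ 0#
        z≈0 I = w-independent (λ i → z i I) (λ i → proj₁ (proj₂ (family i)) I) (s≈0 I)

-- Elements of a generated field involve finitely many generators.

module FiniteSupport {ℓ} (F : HeytingField ℓ ℓ ℓ) (em : ExcludedMiddle ℓ) where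
  open Over F
  open FieldTheory F em

  range-++ˡ : ∀ {m n} (b : Vector Carrier m) (b′ : Vector Carrier n) → Range b ⊆ Range (b ++ b′)
  range-++ˡ {n = n} b b′ (i , x≈) = i ↑ˡ n , trans x≈ (reflexive (≡.sym (Vector.lookup-++ˡ b b′ i)))

  range-++ʳ : ∀ {m n} (b : Vector Carrier m) (b′ : Vector Carrier n) → Range b′ ⊆ Range (b ++ b′)
  range-++ʳ {m} b b′ (i , x≈) = m ↑ʳ i , trans x≈ (reflexive (≡.sym (Vector.lookup-++ʳ b b′ i)))

  ++-all : ∀ {A : Subset} {m n} (b : Vector Carrier m) (b′ : Vector Carrier n) →
           (∀ i → b i ∈ A) → (∀ i → b′ i ∈ A) → ∀ i → (b ++ b′) i ∈ A
  ++-all {m = m} b b′ b∈A b′∈A i with splitAt m i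
  ... | inj₁ j = b∈A j
  ... | inj₂ j = b′∈A j

  FinitelySupported : Subset → Subset → Subset
  FinitelySupported E A x = ∃[ n ] Σ (Vector Carrier n) λ b → (∀ i → b i ∈ A) × x ∈ E ⟨ Range b ⟩

  -- The finitely supported elements form a subfield, because two supports can be concatenated.
  finite-support : ∀ {E A} → E ⟨ A ⟩ ⊆ FinitelySupported E A
  finite-support {E} {A} = ⟨⟩-least isSubfield
    (λ x∈E → 0 , (λ ()) , (λ ()) , base⊆⟨⟩ x∈E)
    (λ {x} x∈A → 1 , (λ _ → x) , (λ _ → x∈A) , generators⊆⟨⟩ (zero , refl))
    where
    module _ {m n} (b : Vector Carrier m) (b′ : Vector Carrier n) where
      widenˡ : E ⟨ Range b ⟩ ⊆ E ⟨ Range (b ++ b′) ⟩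
      widenˡ = ⟨⟩-mono id (range-++ˡ b b′)
      widenʳ : E ⟨ Range b′ ⟩ ⊆ E ⟨ Range (b ++ b′) ⟩
      widenʳ = ⟨⟩-mono id (range-++ʳ b b′)
    isSubfield : IsSubfield (FinitelySupported E A)
    isSubfield = record
      { resp-≈     = λ { x≈y (n , b , b∈A , x∈) → n , b , b∈A , resp x≈y x∈ }
      ; 0-closed   = 0 , (λ ()) , (λ ()) , zero
      ; 1-closed   = 0 , (λ ()) , (λ ()) , one
      ; +-closed   = λ { (m , b , b∈A , x∈) (n , b′ , b′∈A , y∈) →
                         m ℕ.+ n , b ++ b′ , ++-all {A} b b′ b∈A b′∈A , add (widenˡ b b′ x∈) (widenʳ b b′ y∈) }
      ; neg-closed = λ { (n , b , b∈A , x∈) → n , b , b∈A , neg x∈ }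
      ; *-closed   = λ { (m , b , b∈A , x∈) (n , b′ , b′∈A , y∈) →
                         m ℕ.+ n , b ++ b′ , ++-all {A} b b′ b∈A b′∈A , mul (widenˡ b b′ x∈) (widenʳ b b′ y∈) }
      ; inv-closed = λ { (n , b , b∈A , x∈) xy≈1 → n , b , b∈A , inv x∈ xy≈1 }
      }

  finite-supports : ∀ {E A m} (x : Vector Carrier m) → (∀ i → x i ∈ E ⟨ A ⟩) →
    ∃[ n ] Σ (Vector Carrier n) λ b → (∀ i → b i ∈ A) × (∀ i → x i ∈ E ⟨ Range b ⟩)
  finite-supports {m = zero} x x∈ = 0 , (λ ()) , (λ ()) , λ ()
  finite-supports {E} {A} {suc m} x x∈ with finite-support (x∈ zero) | finite-supports {E} {A} (tail x) (x∈ ∘ suc)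
  ... | n , b , b∈A , x₀∈ | n′ , b′ , b′∈A , x₊∈ = n ℕ.+ n′ , b ++ b′ , ++-all {A} b b′ b∈A b′∈A , λ
    { zero    → ⟨⟩-mono id (range-++ˡ b b′) x₀∈
    ; (suc i) → ⟨⟩-mono id (range-++ʳ b b′) (x₊∈ i) }

-- Values of terms and the Λ-closure.

module Terms {ℓ} (F : HeytingField ℓ ℓ ℓ) (em : ExcludedMiddle ℓ) where
  open Over F
  open Interpretation em
  open FieldTheory F em
  open Adjunction F em
  open FiniteSupport F em
  open Separability F em

  product-cong : ∀ {n} {f g : Vector Carrier n} → (∀ i → f i ≈ g i) → product f ≈ product g
  product-cong {zero}  f≈g = refl
  product-cong {suc n} f≈g = *-cong (f≈g zero) (product-cong (f≈g ∘ suc))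

  lambda-family-resp : ∀ {q n} {b b′ : Vector Carrier n} {x x′ f} → (∀ i → b i ≈ b′ i) → x ≈ x′ →
                       IsLambdaFamily q b x f → IsLambdaFamily q b′ x′ f
  lambda-family-resp {q} {n} b≈b′ x≈x′ x≈ = trans (sym x≈x′) (trans x≈
    (sumExponents-cong q n (λ I → *-congʳ (product-cong (λ i → ^-congˡ (toℕ (Vec.lookup I i)) (b≈b′ i))))))

  Defined : ∀ q {n} → Carrier → Vector Carrier n → Set ℓ
  Defined q x b = IsCharacteristic q × IsPIndependentTuple q b × x ∈ (Whole ^⦅ q ⦆) ⟨ Range b ⟩

  defined-resp : ∀ {q n x x′} {b b′ : Vector Carrier n} → x ≈ x′ → (∀ i → b i ≈ b′ i) → Defined q x b → Defined q x′ b′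
  defined-resp {b = b} {b′} x≈x′ b≈b′ (char , (distinct , _ , independent) , x∈) = char ,
    ((λ i j eq → distinct i j (trans (b≈b′ i) (trans eq (sym (b≈b′ j))))) , _ ,
     λ y y∈ y∈⟨⟩ → independent y (back y∈) (⟨⟩-mono id (λ (z∈ , z≉y) → back z∈ , z≉y) y∈⟨⟩)) ,
    resp x≈x′ (⟨⟩-mono id (λ (i , y≈) → i , trans y≈ (b≈b′ i)) x∈)
    where
    back : Range b′ ⊆ Range b
    back (i , y≈) = i , trans y≈ (sym (b≈b′ i))

  -- Both default branches give `0#`, so a set containing it only has to be tested on genuine
  -- λ-families.
  ⟦l⟧-elim : ∀ {q n} (I : Vec (Fin q) n) x b {E : Subset} → 0# ∈ E →
             (Defined q x b → ∀ {f} → IsLambdaFamily q b x f → f I ∈ E) → ⟦l⟧ I x b ∈ E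
  ⟦l⟧-elim {q} I x b 0∈E h with em {IsCharacteristic q × IsPIndependentTuple q b × x ∈ (Whole ^⦅ q ⦆) ⟨ Range b ⟩}
  ... | no _ = 0∈E
  ... | yes d with em {∃ (IsLambdaFamily q b x)}
  ...   | yes (f , x≈) = h d x≈
  ...   | no _         = 0∈E

  -- The witness chosen by excluded middle does not depend on I, so the values for all I come from
  -- one and the same family.
  ⟦l⟧-family : ∀ {q n x} {b : Vector Carrier n} → q ≢ 0 → Defined q x b → IsLambdaFamily q b x (λ I → ⟦l⟧ I x b)
  ⟦l⟧-family {q} {x = x} {b} q≢0 d with em {IsCharacteristic q × IsPIndependentTuple q b × x ∈ (Whole ^⦅ q ⦆) ⟨ Range b ⟩}
  ... | no ¬d = contradiction d ¬d
  ... | yes (char , _ , x∈) with em {∃ (IsLambdaFamily q b x)}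
  ...   | yes (f , x≈) = x≈
  ...   | no ¬family   = contradiction (forget (lambda-family whole-isSubfield b _ x∈)) ¬family
    where
    open Tuples q≢0 char
    forget : Σ _ (λ f → (∀ I → f I ∈ Whole) × IsLambdaFamily q b x f) → ∃ (IsLambdaFamily q b x)
    forget (f , _ , x≈) = f , x≈

  -- The families chosen for equal but not identical arguments may differ as witnesses; uniqueness
  -- of λ-families makes their members equal.
  ⟦l⟧-cong : ∀ {q n} → q ≢ 0 → (I : Vec (Fin q) n) → ∀ {x x′ b b′} → x ≈ x′ → (∀ i → b i ≈ b′ i) →
             ⟦l⟧ I x b ≈ ⟦l⟧ I x′ b′
  ⟦l⟧-cong {q} q≢0 I {x} {x′} {b} {b′} x≈x′ b≈b′ = compare em
    where
    compare : Dec (Defined q x b) → ⟦l⟧ I x b ≈ ⟦l⟧ I x′ b′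
    compare (no ¬d) = trans (vanishes ¬d) (sym (vanishes (¬d ∘ defined-resp (sym x≈x′) (sym ∘ b≈b′))))
      where
      vanishes : ∀ {x b} → ¬ Defined q x b → ⟦l⟧ I x b ≈ 0#
      vanishes {x} {b} ¬d = ⟦l⟧-elim I x b {_≈ 0#} refl (λ d → contradiction d ¬d)
    compare (yes d@(char , independent , _)) = lambda-family-unique (pIndependent⇒tower independent)
      (⟦l⟧-family q≢0 d)
      (lambda-family-resp (sym ∘ b≈b′) (sym x≈x′) (⟦l⟧-family q≢0 (defined-resp x≈x′ b≈b′ d))) I
      where open Tuples q≢0 char

  prime≢0 : ∀ {q} → Prime q → q ≢ 0
  prime≢0 {q} q-prime = ℕ.≢-nonZero⁻¹ q {{prime⇒nonZero q-prime}}

  rename : ∀ {v w} {V : Set v} {W : Set w} → (V → W) → Term V → Term W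
  rename f (var y)            = var (f y)
  rename f (l q-prime I t u)  = l q-prime I (rename f t) (λ i → rename f (u i))

  ⟦rename⟧ : ∀ {v w} {V : Set v} {W : Set w} (f : V → W) {ρ : W → Carrier} {σ : V → Carrier} →
             (∀ y → σ y ≈ ρ (f y)) → ∀ t → ⟦ t ⟧ σ ≈ ⟦ rename f t ⟧ ρ
  ⟦rename⟧ f σ≈ρ (var y)           = σ≈ρ y
  ⟦rename⟧ f σ≈ρ (l q-prime I t u) = ⟦l⟧-cong (prime≢0 q-prime) I (⟦rename⟧ f σ≈ρ t) (λ i → ⟦rename⟧ f σ≈ρ (u i))

  module _ {A : Subset} where

    common-variables : ∀ {n} (x : Vector Carrier n) → (∀ i → IsTermValue A (x i)) →
      ∃[ m ] Σ (Vector Carrier m) λ ρ → (∀ i → ρ i ∈ A) ×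
        Σ (Vector (Term (Fin m)) n) λ t → ∀ i → x i ≈ ⟦ t i ⟧ ρ
    common-variables {zero}  x _ = 0 , (λ ()) , (λ ()) , (λ ()) , λ ()
    common-variables {suc n} x x∈ with x∈ zero | common-variables (tail x) (x∈ ∘ suc)
    ... | m , t , ρ , ρ∈A , x₀≈ | m′ , ρ′ , ρ′∈A , t′ , x₊≈ =
      m ℕ.+ m′ , ρ ++ ρ′ , ++-all {A} ρ ρ′ ρ∈A ρ′∈A , (rename (_↑ˡ m′) t Vector.∷ λ i → rename (m ↑ʳ_) (t′ i)) , λ
      { zero    → trans x₀≈ (⟦rename⟧ (_↑ˡ m′) (λ y → reflexive (≡.sym (Vector.lookup-++ˡ ρ ρ′ y))) t)
      ; (suc i) → trans (x₊≈ i) (⟦rename⟧ (m ↑ʳ_) (λ y → reflexive (≡.sym (Vector.lookup-++ʳ ρ ρ′ y))) (t′ i)) }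

    -- Finitely many terms can be renamed to use one common list of variables, and then a further
    -- symbol can be applied to them.
    ⟦l⟧-term-value : ∀ {q n} → Prime q → (I : Vec (Fin q) n) → ∀ {x b} →
      IsTermValue A x → (∀ i → IsTermValue A (b i)) → IsTermValue A (⟦l⟧ I x b)
    ⟦l⟧-term-value q-prime I {x} {b} x∈ b∈ with common-variables (x Vector.∷ b) (λ { zero → x∈ ; (suc i) → b∈ i })
    ... | m , ρ , ρ∈A , t , eq = m , l q-prime I (t zero) (tail t) , ρ , ρ∈A ,
      ⟦l⟧-cong (prime≢0 q-prime) I (eq zero) (eq ∘ suc)

    variable-value : A ⊆ IsTermValue A
    variable-value {x} x∈A = 1 , var zero , (λ _ → x) , (λ _ → x∈A) , refl

    term-value-resp : IsTermValue A Respects _≈_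
    term-value-resp x≈y (m , t , ρ , ρ∈A , x≈) = m , t , ρ , ρ∈A , trans (sym x≈y) x≈

  ClosedUnder-⟦l⟧ : Subset → Set ℓ
  ClosedUnder-⟦l⟧ E = ∀ {q n} → Prime q → (I : Vec (Fin q) n) → ∀ {x b} → x ∈ E → (∀ i → b i ∈ E) → ⟦l⟧ I x b ∈ E

  term-values⊆ : ∀ {A E} → E Respects _≈_ → ClosedUnder-⟦l⟧ E → A ⊆ E → IsTermValue A ⊆ E
  term-values⊆ {A} {E} E-resp closed A⊆E (m , t , ρ , ρ∈A , x≈) = E-resp (sym x≈) (value∈E t)
    where
    value∈E : ∀ t → ⟦ t ⟧ ρ ∈ E
    value∈E (var y)           = A⊆E (ρ∈A y)
    value∈E (l q-prime I t u) = closed q-prime I (value∈E t) (λ i → value∈E (u i))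

  separable⇒closed : ∀ {p E} → IsCharacteristicExponent p → IsSubfield E → IsSeparable F p E → ClosedUnder-⟦l⟧ E
  -- In characteristic 0 the symbols of every prime take their default value, so only 0 has to lie
  -- in E.
  separable⇒closed {E = E} (characteristic-zero char₀) E-isSubfield _ {q} q-prime I {x} {b} x∈E b∈E =
    ⟦l⟧-elim I x b {E} (IsSubfield.0-closed E-isSubfield)
      (λ (char , _) → contradiction (0∣⇒≡0 (Equivalence.to (char₀ q) (Equivalence.from (char q) ∣-refl))) (prime≢0 q-prime))
  separable⇒closed {p} {E} (characteristic-positive p≢0 charₚ) E-isSubfield separable {q} q-prime I {x} {b} x∈E b∈E =
    ⟦l⟧-elim I x b {E} (IsSubfield.0-closed E-isSubfield) (λ d@(char , _) → closed d
      (∣-antisym (Equivalence.to (charₚ q) (Equivalence.from (char q) ∣-refl))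
                 (Equivalence.to (char p) (Equivalence.from (charₚ p) ∣-refl))))
    where
    open Separable p≢0 charₚ
    closed : Defined q x b → p ≡ q → ∀ {f} → IsLambdaFamily q b x f → f I ∈ E
    closed (_ , independent , _) ≡.refl x≈ = lambda-family-closed E-isSubfield (separable⇒frobenius separable)
      b∈E (pIndependent⇒tower independent) x∈E x≈ I

  -- With exponent 1 the roots of elements of E are these elements themselves, and F serves as its
  -- own overfield.
  everything-separable₁ : ∀ {E} → IsSubfield E → IsSeparable F 1 E
  everything-separable₁ {E} E-isSubfield =
    record { Ω = F ; ι = id ; ι-isRingHomomorphism = Identity.isRingHomomorphism rawRing refl } ,
    (λ x _ → x , *-identityʳ x) ,
    λ n v _ independent a a∈ → independent a (λ i → let (y , y∈E , aᵢ≈) = a∈ i in y , y∈E , trans (sym (*-identityʳ (a i))) aᵢ≈)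

  module _ {p} (p≢0 : p ≢ 0) (char : IsCharacteristic p) {C c A : Subset}
           (C⊆Cᵖ⟨c⟩ : C ⊆ (C ^⦅ p ⦆) ⟨ c ⟩) (c⊆A : c ⊆ A) where
    open Separable p≢0 char

    private
      T E : Subset
      T = IsTermValue A
      E = C ⟨ T ⟩

      E-isSubfield : IsSubfield E
      E-isSubfield = ⟨⟩-isSubfield C T

      E⊆Eᵖ⟨T⟩ : E ⊆ (E ^⦅ p ⦆) ⟨ T ⟩
      E⊆Eᵖ⟨T⟩ = ⟨⟩-least (⟨⟩-isSubfield (E ^⦅ p ⦆) T)
        (⟨⟩-mono (λ (y , y∈C , x≈) → y , base⊆⟨⟩ y∈C , x≈) (λ x∈c → variable-value {A} (c⊆A x∈c)) ∘ C⊆Cᵖ⟨c⟩) generators⊆⟨⟩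

      module _ {n} (b : Vector Carrier n) (b∈T : ∀ i → b i ∈ T) (ind : TowerIndependent b) where
        -- The λ-coordinates of x are term values again, so the coefficients of its expansion are
        -- p-th powers from E and not merely from F.
        T∩Fᵖ⟨b⟩⊆Eᵖ⟨b⟩ : ∀ {x} → x ∈ T → x ∈ (Whole ^⦅ p ⦆) ⟨ Range b ⟩ → x ∈ (E ^⦅ p ⦆) ⟨ Range b ⟩
        T∩Fᵖ⟨b⟩⊆Eᵖ⟨b⟩ {x} x∈T x∈ = IsSubfield.resp-≈ K-isSubfield
          (sym (⟦l⟧-family p≢0 (char , tower⇒pIndependent ind , x∈)))
          (sumExponents-closed K-isSubfield p n (λ I → IsSubfield.*-closed K-isSubfield
            (monomial-closed K-isSubfield (λ i → generators⊆⟨⟩ (i , refl)) I)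
            (base⊆⟨⟩ (⟦l⟧ I x b , generators⊆⟨⟩ (⟦l⟧-term-value {A} p-prime I x∈T b∈T) , refl))))
          where
          K-isSubfield = ⟨⟩-isSubfield (E ^⦅ p ⦆) (Range b)

      locally : ∀ {m} (a : Vector Carrier m) → (∀ i → a i ∈ E) →
        ∃[ n ] Σ (Vector Carrier n) λ b → (∀ j → b j ∈ E) × TowerIndependent b × (∀ i → a i ∈ (E ^⦅ p ⦆) ⟨ Range b ⟩)
      locally a a∈E with finite-supports {E ^⦅ p ⦆} {T} a (λ i → E⊆Eᵖ⟨T⟩ (a∈E i))
      ... | _ , t , t∈T , a∈ with maximal-independent {T} t t∈T
      ...   | n , b , b∈T , ind , t∈ = n , b , (λ j → generators⊆⟨⟩ (b∈T j)) , ind , λ i →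
        ⟨⟩-least (⟨⟩-isSubfield (E ^⦅ p ⦆) (Range b)) base⊆⟨⟩
          (λ (j , y≈) → resp (sym y≈) (T∩Fᵖ⟨b⟩⊆Eᵖ⟨b⟩ b b∈T ind (t∈T j) (t∈ j))) (a∈ i)

    term-values-separable : IsSeparable F p (C ⟨ IsTermValue A ⟩)
    term-values-separable = frobenius⇒separable E-isSubfield (locally-generated⇒frobenius E-isSubfield locally)

  isLambdaClosure : ∀ {p} → IsCharacteristicExponent p → ∀ {C c a} → IsPBasis p C c →
                    IsLambdaClosure F p (C ⟨ a ⟩) (C ⟨ IsTermValue (c ∪ a) ⟩)
  isLambdaClosure {p} exponent {C} {c} {a} ((c⊆C , _) , C⊆Cᵖ⟨c⟩ , _) = record
    { isSubfield  = ⟨⟩-isSubfield C (IsTermValue (c ∪ a))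
    ; contains    = ⟨⟩-mono id (λ x∈a → variable-value {c ∪ a} (inj₂ x∈a))
    ; isSeparable = separable exponent C⊆Cᵖ⟨c⟩
    ; smallest    = λ E E-isSubfield C⟨a⟩⊆E E-separable → ⟨⟩-least E-isSubfield (C⟨a⟩⊆E ∘ base⊆⟨⟩)
        (term-values⊆ {c ∪ a} (IsSubfield.resp-≈ E-isSubfield) (separable⇒closed exponent E-isSubfield E-separable)
          λ { (inj₁ x∈c) → C⟨a⟩⊆E (base⊆⟨⟩ (c⊆C x∈c)) ; (inj₂ x∈a) → C⟨a⟩⊆E (generators⊆⟨⟩ x∈a) })
    }
    where
    separable : ∀ {p} → IsCharacteristicExponent p → C ⊆ (C ^⦅ p ⦆) ⟨ c ⟩ → IsSeparable F p (C ⟨ IsTermValue (c ∪ a) ⟩)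
    separable (characteristic-zero _) _ = everything-separable₁ (⟨⟩-isSubfield C (IsTermValue (c ∪ a)))
    separable (characteristic-positive p≢0 char) C⊆ = term-values-separable p≢0 char {A = c ∪ a} C⊆ inj₁

  -- Equal subfields may be given by different predicates; the overfield that witnesses separability
  -- is kept.
  isLambdaClosure-resp : ∀ {p D E E′} → IsSubfield E′ → E ⊆ E′ → E′ ⊆ E →
                         IsLambdaClosure F p D E → IsLambdaClosure F p D E′
  isLambdaClosure-resp {p} {D} {E} {E′} E′-isSubfield E⊆E′ E′⊆E Λ = record
    { isSubfield  = E′-isSubfield
    ; contains    = E⊆E′ ∘ Λ.contains
    ; isSeparable = let (O , hasRoots , disjoint) = Λ.isSeparable in
        O , (λ x x∈ → hasRoots x (E′⊆E x∈)) , λ n v v∈ independent a a∈ →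
          disjoint n v v∈ (λ d d∈ → independent d (λ i → let (x , x∈ , d≈) = d∈ i in x , E⊆E′ x∈ , d≈))
            a (λ i → let (x , x∈ , a≈) = a∈ i in x , E′⊆E x∈ , a≈)
    ; smallest    = λ K K-isSubfield D⊆K K-separable → Λ.smallest K K-isSubfield D⊆K K-separable ∘ E′⊆E
    }
    where module Λ = IsLambdaClosure Λ

-- Intermediate fields of finitely generated extensions.

module FiniteGeneration {ℓ} (F : HeytingField ℓ ℓ ℓ) (em : ExcludedMiddle ℓ) where
  open Over F
  open FieldTheory F em
  open Powers F em
  open Adjunction F em
  open FiniteSupport F em
  open SemiringSum semiring using (sum-init-last)
  open import Relation.Binary.Reasoning.Setoid setoid

  record IsSubring (P : Subset) : Set ℓ where
    field
      resp-≈     : P Respects _≈_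
      0-closed   : 0# ∈ P
      1-closed   : 1# ∈ P
      +-closed   : ∀ {x y} → x ∈ P → y ∈ P → (x + y) ∈ P
      neg-closed : ∀ {x} → x ∈ P → (- x) ∈ P
      *-closed   : ∀ {x y} → x ∈ P → y ∈ P → (x * y) ∈ P

  Fraction : Subset → Subset
  Fraction P y = ∃[ f ] ∃[ g ] f ∈ P × g ∈ P × ¬ (g ≈ 0#) × y * g ≈ f

  module _ {P : Subset} (P-isSubring : IsSubring P) where
    open IsSubring P-isSubring

    P⊆Fraction : P ⊆ Fraction P
    P⊆Fraction {y} y∈P = y , 1# , y∈P , 1-closed , 1≉0 , *-identityʳ y

    fraction-isSubfield : IsSubfield (Fraction P)
    fraction-isSubfield = record
      { resp-≈     = λ { x≈y (f , g , f∈ , g∈ , g≉0 , eq) → f , g , f∈ , g∈ , g≉0 , trans (*-congʳ (sym x≈y)) eq }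
      ; 0-closed   = P⊆Fraction 0-closed
      ; 1-closed   = P⊆Fraction 1-closed
      ; +-closed   = λ { {x} {y} (f , g , f∈ , g∈ , g≉0 , eq) (f′ , g′ , f′∈ , g′∈ , g′≉0 , eq′) →
          f * g′ + f′ * g , g * g′ , +-closed (*-closed f∈ g′∈) (*-closed f′∈ g∈) , *-closed g∈ g′∈ , *-≉0 g≉0 g′≉0 ,
          trans (solve 4 (λ x y g g′ → (x :+ y) :* (g :* g′) := (x :* g) :* g′ :+ (y :* g′) :* g) refl x y g g′)
                (+-cong (*-congʳ eq) (*-congʳ eq′)) }
      ; neg-closed = λ { {x} (f , g , f∈ , g∈ , g≉0 , eq) →
          - f , g , neg-closed f∈ , g∈ , g≉0 , trans (sym (-‿distribˡ-* x g)) (-‿cong eq) }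
      ; *-closed   = λ { {x} {y} (f , g , f∈ , g∈ , g≉0 , eq) (f′ , g′ , f′∈ , g′∈ , g′≉0 , eq′) →
          f * f′ , g * g′ , *-closed f∈ f′∈ , *-closed g∈ g′∈ , *-≉0 g≉0 g′≉0 ,
          trans (solve 4 (λ x y g g′ → (x :* y) :* (g :* g′) := (x :* g) :* (y :* g′)) refl x y g g′) (*-cong eq eq′) }
      ; inv-closed = λ { {x} {y} (f , g , f∈ , g∈ , g≉0 , eq) xy≈1 →
          g , f , g∈ , f∈ ,
          (λ f≈0 → g≉0 (xy≈0∧x≉0⇒y≈0 (trans eq f≈0) (λ x≈0 → 1≉0 (trans (sym xy≈1) (trans (*-congʳ x≈0) (zeroˡ y)))))) ,
          trans (*-congˡ (sym eq)) (trans (solve 3 (λ x y g → y :* (x :* g) := (x :* y) :* g) refl x y g)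
            (trans (*-congʳ xy≈1) (*-identityˡ g))) }
      }

  module _ {E : Subset} (E-isSubfield : IsSubfield E) (x : Carrier) where
    private module E where
      open SubfieldProperties E-isSubfield public
      open Polynomial E-isSubfield x public

    -- `independent-∷` puts the new vector first, whereas the top power comes last; the sum is
    -- rotated accordingly.
    independent-suc : ∀ {n} → LinearlyIndependent E (powers x n) → ¬ ((x ^ n) ∈ E.Poly n) →
                      LinearlyIndependent E (powers x (suc n))
    independent-suc {n} independent xⁿ∉ a a∈E eq i = all-zero (view i)
      where
      a′≈0 = E.independent-∷ independent xⁿ∉ (a (fromℕ n) Vector.∷ (a ∘ inject₁))
        (E.∷-closed (a∈E (fromℕ n)) (a∈E ∘ inject₁)) (begin
          a (fromℕ n) * x ^ n + sum (λ i → a (inject₁ i) * x ^ toℕ i)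
            ≈⟨ +-comm _ _ ⟩
          sum (λ i → a (inject₁ i) * x ^ toℕ i) + a (fromℕ n) * x ^ n
            ≈⟨ +-cong (sum-cong-≋ (λ i → *-congˡ {a (inject₁ i)} (reflexive (≡.cong (x ^_) (Fin.toℕ-inject₁ i)))))
                      (*-congˡ (reflexive (≡.cong (x ^_) (Fin.toℕ-fromℕ n)))) ⟨
          sum (λ i → a (inject₁ i) * x ^ toℕ (inject₁ i)) + a (fromℕ n) * x ^ toℕ (fromℕ n)
            ≈⟨ sum-init-last (λ i → a i * x ^ toℕ i) ⟨
          sum (λ i → a i * x ^ toℕ i)
            ≈⟨ eq ⟩
          0# ∎)

      all-zero : ∀ {i} → View i → a i ≈ 0#
      all-zero ‵fromℕ       = a′≈0 zero
      all-zero (‵inject₁ j) = a′≈0 (suc j)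

    -- The number d is the degree of x over E, and the expansion of xᵈ carries the coefficients of
    -- its minimal polynomial.
    first-dependence : ∀ n → ¬ LinearlyIndependent E (powers x n) →
      ∃[ d ] LinearlyIndependent E (powers x d) × (x ^ d) ∈ E.Poly d
    first-dependence zero    dependent = contradiction (λ _ _ _ ()) dependent
    first-dependence (suc n) dependent with em {LinearlyIndependent E (powers x n)}
    ... | no dependent′   = first-dependence n dependent′
    ... | yes independent with em {(x ^ n) ∈ E.Poly n}
    ...   | yes xⁿ∈ = n , independent , xⁿ∈
    ...   | no xⁿ∉  = contradiction (independent-suc independent xⁿ∉) dependent

    module _ {K : Subset} (K-isSubfield : IsSubfield K) (K⊆E : K ⊆ E) where
      private module K where
        open SubfieldProperties K-isSubfield public
        open Polynomial K-isSubfield x public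

      -- From e * g(x) = f(x) compare the coefficients of the powers of x, which lie in E.
      fraction-coefficient : ∀ {n e f g} → LinearlyIndependent E (powers x n) → e ∈ E →
        f ∈ K.Poly n → g ∈ K.Poly n → ¬ (g ≈ 0#) → e * g ≈ f → e ∈ K
      fraction-coefficient {n} {e} {f} {g} independent e∈E
        (K.combination a a∈K f≈) (K.combination b b∈K g≈) g≉0 eg≈f with em {∃[ i ] ¬ (b i ≈ 0#)}
      ... | no ¬b≉0 = contradiction (trans g≈ (sum-zero (λ i → trans (*-congʳ (b≈0 i)) (zeroˡ _)))) g≉0
        where
        b≈0 : ∀ i → b i ≈ 0#
        b≈0 i with em {b i ≈ 0#}
        ... | yes bᵢ≈0 = bᵢ≈0
        ... | no bᵢ≉0  = contradiction (i , bᵢ≉0) ¬b≉0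
      ... | yes (i , bᵢ≉0) with inverse bᵢ≉0
      ...   | y , bᵢy≈1 = K.resp-≈ (begin
        a i * y          ≈⟨ *-congʳ (eb≈a i) ⟨
        e * b i * y      ≈⟨ *-assoc e (b i) y ⟩
        e * (b i * y)    ≈⟨ trans (*-congˡ bᵢy≈1) (*-identityʳ e) ⟩
        e                ∎) (K.*-closed (a∈K i) (K.inv-closed (b∈K i) bᵢy≈1))
        where
        eb≈a : ∀ i → e * b i ≈ a i
        eb≈a = E.independent-unique independent (λ i → E.*-closed e∈E (K⊆E (b∈K i))) (λ i → K⊆E (a∈K i)) (begin
          sum (λ i → e * b i * x ^ toℕ i)   ≈⟨ *-sum-commute e b (powers x n) ⟨
          e * sum (λ i → b i * x ^ toℕ i)   ≈⟨ *-congˡ g≈ ⟨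
          e * g                             ≈⟨ trans eg≈f f≈ ⟩
          sum (λ i → a i * x ^ toℕ i)       ∎)

      -- `P` plays the role of K[x]: an element of E ⊆ K(x) is a fraction with numerator and
      -- denominator in `P`, to which `fraction-coefficient` applies. The algebraic and the
      -- transcendental case differ only in how `P` and the independent powers are obtained.
      descend : ∀ {P} → IsSubring P → K ⊆ P → x ∈ P →
        (∀ {f g} → f ∈ P → g ∈ P → ∃[ n ] LinearlyIndependent E (powers x n) × f ∈ K.Poly n × g ∈ K.Poly n) →
        E ⊆ K ⟨ Only x ⟩ → E ⊆ K
      descend {P} P-isSubring K⊆P x∈P independent E⊆K⟨x⟩ e∈E
        with ⟨⟩-least {K} {Only x} (fraction-isSubfield P-isSubring) (λ k∈K → P⊆Fraction P-isSubring (K⊆P k∈K))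
               (λ y≈x → P⊆Fraction P-isSubring (IsSubring.resp-≈ P-isSubring (sym y≈x) x∈P)) (E⊆K⟨x⟩ e∈E)
      ... | f , g , f∈P , g∈P , g≉0 , eg≈f with independent f∈P g∈P
      ...   | n , powers-independent , f∈ , g∈ = fraction-coefficient powers-independent e∈E f∈ g∈ g≉0 eg≈f

      -- The relation for xᵈ has coefficients in K, so K[x] is spanned by the powers below d, which
      -- are independent even over E.
      algebraic-descend : ∀ {d} → LinearlyIndependent E (powers x d) → (x ^ d) ∈ K.Poly d →
                          E ⊆ K ⟨ Only x ⟩ → E ⊆ K
      algebraic-descend {d} independent xᵈ∈ = descend {K.Poly d} isSubring (K.constant∈Poly 0<d)
        (K.span-resp (*-identityʳ x) (K.Reduced.reduced-x* xᵈ∈ (K.constant∈Poly 0<d K.1-closed)))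
        (λ f∈ g∈ → d , independent , f∈ , g∈)
        where
        positive : ∀ {d} → (x ^ d) ∈ K.Poly d → 0 ℕ.< d
        positive {zero}  (K.combination _ _ 1≈0) = contradiction 1≈0 1≉0
        positive {suc d} _                       = z<s

        0<d : 0 ℕ.< d
        0<d = positive xᵈ∈

        isSubring : IsSubring (K.Poly d)
        isSubring = record
          { resp-≈ = K.span-resp ; 0-closed = K.span-zero ; 1-closed = K.constant∈Poly 0<d K.1-closed
          ; +-closed = K.span-+ ; neg-closed = K.span-neg ; *-closed = K.Reduced.reduced-* xᵈ∈ }

      transcendental-descend : (∀ n → LinearlyIndependent E (powers x n)) → E ⊆ K ⟨ Only x ⟩ → E ⊆ K
      transcendental-descend independent = descend {λ y → ∃[ n ] y ∈ K.Poly n} isSubring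
        (λ k∈K → 1 , K.constant∈Poly z<s k∈K)
        (2 , K.span-resp (*-identityʳ x) (K.power∈Poly {1} (s≤s z<s)))
        (λ (m , f∈) (n , g∈) → m ℕ.⊔ n , independent (m ℕ.⊔ n) ,
          K.poly-mono (ℕ.m≤m⊔n m n) f∈ , K.poly-mono (ℕ.m≤n⊔m m n) g∈)
        where
        isSubring : IsSubring (λ y → ∃[ n ] y ∈ K.Poly n)
        isSubring = record
          { resp-≈     = λ x≈y (n , x∈) → n , K.span-resp x≈y x∈
          ; 0-closed   = 0 , K.span-zero
          ; 1-closed   = 1 , K.constant∈Poly z<s K.1-closed
          ; +-closed   = λ (m , f∈) (n , g∈) → m ℕ.⊔ n ,
              K.span-+ (K.poly-mono (ℕ.m≤m⊔n m n) f∈) (K.poly-mono (ℕ.m≤n⊔m m n) g∈)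
          ; neg-closed = λ (n , f∈) → n , K.span-neg f∈
          ; *-closed   = λ (m , f∈) (n , g∈) → m ℕ.+ n , K.*-poly-+ f∈ g∈ }

    -- It suffices that K contains the coefficients of the minimal polynomial of x over E.
    simple-descend : ∃[ m ] Σ (Vector Carrier m) λ k → (∀ i → k i ∈ E) ×
      (∀ {K} → IsSubfield K → K ⊆ E → (∀ i → k i ∈ K) → E ⊆ K ⟨ Only x ⟩ → E ⊆ K)
    simple-descend with em {∃[ n ] ¬ LinearlyIndependent E (powers x n)}
    ... | yes (n , dependent) with first-dependence n dependent
    ...   | d , independent , E.combination k k∈E xᵈ≈ = d , k , k∈E , λ K-isSubfield K⊆E k∈K →
      algebraic-descend K-isSubfield K⊆E independent (SubfieldProperties.combination k k∈K xᵈ≈)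
    -- A transcendental x has no minimal polynomial, so nothing is required of K.
    simple-descend | no ¬dependent = 0 , (λ ()) , (λ ()) , λ K-isSubfield K⊆E _ →
      transcendental-descend K-isSubfield K⊆E independent
      where
      independent : ∀ n → LinearlyIndependent E (powers x n)
      independent n with em {LinearlyIndependent E (powers x n)}
      ... | yes independent′ = independent′
      ... | no dependent     = contradiction (n , dependent) ¬dependent

  -- Adjoin x₀ to both fields. By induction E(x₀) is generated over C(x₀) by some e₁, which are
  -- rational in x₀ and finitely many elements e₂ of E. Let K be generated over C by e₂ and the
  -- elements k that `simple-descend` provides for x₀; then E ⊆ K(x₀), hence E ⊆ K.
  intermediate-finitely-generated : ∀ {n} (x : Vector Carrier n) {C E} → IsSubfield E →
    C ⊆ E → E ⊆ C ⟨ Range x ⟩ →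
    ∃[ m ] Σ (Vector Carrier m) λ e → (∀ i → e i ∈ E) × E ⊆ C ⟨ Range e ⟩
  intermediate-finitely-generated {zero} x E-isSubfield C⊆E E⊆ =
    0 , (λ ()) , (λ ()) , λ e∈E → ⟨⟩-mono id (λ ()) (E⊆ e∈E)
  intermediate-finitely-generated {suc n} x {C} {E} E-isSubfield C⊆E E⊆
    with intermediate-finitely-generated (tail x) {C ⟨ Only (x zero) ⟩} {E ⟨ Only (x zero) ⟩}
           (⟨⟩-isSubfield E (Only (x zero))) (⟨⟩-mono C⊆E id)
           (⟨⟩-least (⟨⟩-isSubfield _ _) (λ e∈E → swap (range-split x (E⊆ e∈E))) (λ y≈ → base⊆⟨⟩ (generators⊆⟨⟩ y≈)))
    where
    swap : C ⟨ Range (tail x) ⟩ ⟨ Only (x zero) ⟩ ⊆ C ⟨ Only (x zero) ⟩ ⟨ Range (tail x) ⟩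
    swap = ⟨⟩-least (⟨⟩-isSubfield _ _) (⟨⟩-mono base⊆⟨⟩ id) (λ y≈ → base⊆⟨⟩ (generators⊆⟨⟩ y≈))
  -- The roles of base and generators are interchanged, so that the finite support is taken among
  -- elements of E, with x₀ in the base.
  ... | _ , e₁ , e₁∈ , E⟨x₀⟩⊆ with finite-supports {Only (x zero)} {E} e₁
                                     (λ i → ⟨⟩-least (⟨⟩-isSubfield _ _) generators⊆⟨⟩ base⊆⟨⟩ (e₁∈ i))
                                 | simple-descend E-isSubfield (x zero)
  ...   | m , e₂ , e₂∈E , e₁∈⟨e₂⟩ | m′ , k , k∈E , descend-to = m ℕ.+ m′ , e₂ ++ k , ++-all {E} e₂ k e₂∈E k∈E ,
    descend-to (⟨⟩-isSubfield C (Range (e₂ ++ k)))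
      (⟨⟩-least E-isSubfield C⊆E λ (i , y≈) → IsSubfield.resp-≈ E-isSubfield (sym y≈) (++-all {E} e₂ k e₂∈E k∈E i))
      (λ i → generators⊆⟨⟩ (range-++ʳ e₂ k (i , refl)))
      (λ e∈E → ⟨⟩-least K⟨x₀⟩-isSubfield (⟨⟩-mono base⊆⟨⟩ id)
        (λ (i , y≈) → resp (sym y≈) (⟨⟩-least K⟨x₀⟩-isSubfield generators⊆⟨⟩
          (λ y∈ → base⊆⟨⟩ (generators⊆⟨⟩ (range-++ˡ e₂ k y∈))) (e₁∈⟨e₂⟩ i)))
        (E⟨x₀⟩⊆ (base⊆⟨⟩ e∈E)))
    where
    K⟨x₀⟩-isSubfield = ⟨⟩-isSubfield (C ⟨ Range (e₂ ++ k) ⟩) (Only (x zero))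

theorem1p1 :
  (em : ∀ {ℓ} → ExcludedMiddle ℓ) →
  ∀ {ℓ} (F : HeytingField ℓ ℓ ℓ) →
  let open Over F
      open Interpretation em
  in
  (p : ℕ) → IsCharacteristicExponent p →
  (C : Subset) → IsSubfield C → IsSeparable F p C →
  (c : Subset) → c Respects _≈_ → IsPBasis p C c → WellOrder c →
  (a : Subset) → a Respects _≈_ → WellOrder a →
  Σ Subset λ λa →
    λa Respects _≈_ ×
    IsLambdaClosure F p (C ⟨ a ⟩) (C ⟨ λa ⟩) ×
    (∀ x → x ∈ λa → IsTermValue (c ∪ a) x) ×
    ((b : Subset) → b Respects _≈_ → IsFinite a → IsFinite b →
      Whole ≐ C ⟨ a ∪ b ⟩ →
      Σ Subset λ λab →
        λab Respects _≈_ × IsFinite λab × λab ⊆ λa ×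
        IsLambdaClosure F p (C ⟨ a ⟩) (C ⟨ λab ⟩))
theorem1p1 em F p exponent C C-isSubfield _ c _ c-isPBasis _ a _ _ =
  T , term-value-resp {c ∪ a} , closure , (λ _ x∈T → x∈T) , finite-case
  where
  open Over F
  open Interpretation em
  open FieldTheory F em
  open FiniteSupport F em
  open FiniteGeneration F em
  open Terms F em

  T : Subset
  T = IsTermValue (c ∪ a)

  closure : IsLambdaClosure F p (C ⟨ a ⟩) (C ⟨ T ⟩)
  closure = isLambdaClosure exponent c-isPBasis

  finite-case : (b : Subset) → b Respects _≈_ → IsFinite a → IsFinite b → Whole ≐ C ⟨ a ∪ b ⟩ →
    Σ Subset λ λab → λab Respects _≈_ × IsFinite λab × λab ⊆ T × IsLambdaClosure F p (C ⟨ a ⟩) (C ⟨ λab ⟩)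
  finite-case b _ (_ , as , a⊆as , _) (_ , bs , b⊆bs , _) (F⊆C⟨a∪b⟩ , _)
    with intermediate-finitely-generated (as ++ bs) {C} (⟨⟩-isSubfield C T) base⊆⟨⟩
           (λ _ → ⟨⟩-mono id (λ { (inj₁ x∈a) → range-++ˡ as bs (a⊆as x∈a) ; (inj₂ x∈b) → range-++ʳ as bs (b⊆bs x∈b) })
                    (F⊆C⟨a∪b⟩ _))
  -- The generators `e` of C(T) need not be term values, so they are replaced by the finitely many
  -- term values that they involve.
  ... | _ , e , e∈C⟨T⟩ , C⟨T⟩⊆C⟨e⟩ with finite-supports {C} {T} e e∈C⟨T⟩
  ...   | n , t , t∈T , e∈C⟨t⟩ =
    Range t , (λ x≈y (i , x≈) → i , trans (sym x≈y) x≈) , (n , t , id , id) , Range⊆T ,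
    isLambdaClosure-resp (⟨⟩-isSubfield C (Range t))
      (λ x∈ → ⟨⟩-least (⟨⟩-isSubfield C (Range t)) base⊆⟨⟩ (λ (i , y≈) → resp (sym y≈) (e∈C⟨t⟩ i)) (C⟨T⟩⊆C⟨e⟩ x∈))
      (⟨⟩-mono id Range⊆T) closure
    where
    Range⊆T : Range t ⊆ T
    Range⊆T (i , x≈) = term-value-resp {c ∪ a} (sym x≈) (t∈T i)
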